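{- Let $n\geq 1$ and $k\geq 2$ be integers, and let $w$ be a length-$n$ word over $\Sigma_k$. Then $\operatorname{rankB}_k(w)$ can be computed (from $w$ and $k$) in $O(kn^3)$ time using $O(n)$ space, under the unit-cost RAM model.
   Context: $\Sigma_k=\{1,2,\ldots,k\}$ with $1<2<\cdots<k$, and $\Sigma_k^n$ is the set of length-$n$ words over $\Sigma_k$. Lexicographic order: for $x=x_1\cdots x_m$ and $y=y_1\cdots y_n$, $x<y$ if $x$ is a proper prefix of $y$, or if $x_i<y_i$ for the smallest $i$ with $x_i\neq y_i$. A border of a word $w$ is a word that is both a non-empty proper prefix and a non-empty proper suffix of $w$; $w$ is bordered if it has a border and unbordered otherwise. $\operatorname{rankB}_k(w)$ denotes the rank (position, starting from $1$) of $w$ in the lexicographic listing of all bordered words of length $|w|$ over $\Sigma_k$; for an arbitrary word $w$ of length $n$ this is taken to mean $1$ plus the number of length-$n$ bordered words over $\Sigma_k$ that are lexicographically smaller than $w$. Unit-cost RAM model: integer variables use constant space and integer arithmetic operations take constant time. -}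

module Defs where

open import Data.Bool.Base using (if_then_else_)
open import Data.Fin.Base as Fin using (Fin; toℕ)
import Data.Fin.Properties as Fin
open import Data.Integer.Base as ℤ using (ℤ; +_; -[1+_]; +[1+_]; ∣_∣)
open import Data.List.Base using (List; []; _∷_; length; foldr; filter; inits; head; drop; allFin; cartesianProductWith)
open import Data.List.Properties using (≡-dec)
open import Data.List.Membership.Propositional using (_∈_; lose; find)
open import Data.List.Membership.Propositional.Properties using (∈-map⁺; ∈-allFin; ∈-cartesianProductWith⁺; ∈-cartesianProductWith⁻)
open import Data.List.Relation.Unary.Any using (here; there; any?)
open import Data.List.Relation.Unary.Unique.Propositional using (Unique; []; _∷_)
import Data.List.Relation.Unary.All as All
import Data.List.Relation.Unary.Unique.Propositional.Properties as Unique
open import Data.List.Relation.Binary.Lex.Strict using (Lex-<; <-decidable)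
open import Data.List.Relation.Binary.Prefix.Heterogeneous using (Prefix; []; _∷_)
open import Data.List.Relation.Binary.Prefix.Heterogeneous.Properties using (prefix?)
open import Data.List.Relation.Binary.Suffix.Heterogeneous using (Suffix)
open import Data.List.Relation.Binary.Suffix.Heterogeneous.Properties using (suffix?)
open import Data.Maybe.Base as Maybe using (Maybe; just; nothing)
open import Data.Nat.Base using (ℕ; zero; suc; _+_; _⊔_)
open import Data.Nat.Properties using (_≟_)
open import Data.Product.Base using (∃; _×_; _,_)
open import Relation.Binary.Definitions using (Decidable)
open import Relation.Binary.PropositionalEquality using (_≡_; _≢_; refl; cong)
open import Relation.Nullary.Decidable using (Dec; does; map′; ¬?; _×-dec_)

-- The letter i + 1 of {1,…,k} is represented by the element i of Fin k.
Word : ℕ → Set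
Word k = List (Fin k)

private
  variable
    k : ℕ

infix 4 _<ₗ_ _<ₗ?_

_<ₗ_ : Word k → Word k → Set
_<ₗ_ = Lex-< _≡_ Fin._<_

_<ₗ?_ : Decidable (_<ₗ_ {k})
_<ₗ?_ = <-decidable Fin._≟_ Fin._<?_

IsBorder : Word k → Word k → Set
IsBorder u w = u ≢ [] × u ≢ w × Prefix _≡_ u w × Suffix _≡_ u w

Bordered : Word k → Set
Bordered w = ∃ λ u → IsBorder u w

isBorder? : Decidable (IsBorder {k})
isBorder? u w =
  ¬? (≡-dec Fin._≟_ u []) ×-dec ¬? (≡-dec Fin._≟_ u w) ×-dec
  prefix? Fin._≟_ u w ×-dec suffix? Fin._≟_ u w

prefix⇒∈inits : ∀ {u w : Word k} → Prefix _≡_ u w → u ∈ inits w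
prefix⇒∈inits []           = here refl
prefix⇒∈inits (refl ∷ pre) = there (∈-map⁺ (_ ∷_) (prefix⇒∈inits pre))

bordered? : (w : Word k) → Dec (Bordered w)
bordered? w = map′
  (λ any → let (u , _ , b) = find any in u , b)
  (λ { (u , b@(_ , _ , pre , _)) → lose (prefix⇒∈inits pre) b })
  (any? (λ u → isBorder? u w) (inits w))

words : ∀ k → ℕ → List (Word k)
words k zero    = [] ∷ []
words k (suc n) = cartesianProductWith _∷_ (allFin k) (words k n)

words-complete : (w : Word k) → w ∈ words k (length w)
words-complete []      = here refl
words-complete (x ∷ w) =
  ∈-cartesianProductWith⁺ _∷_ (∈-allFin x) (words-complete w)

words-length : ∀ n {w : Word k} → w ∈ words k n → length w ≡ n
words-length zero    (here refl) = refl
words-length {k} (suc n) w∈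
  with ∈-cartesianProductWith⁻ _∷_ (allFin k) (words k n) w∈
... | _ , _ , _ , v∈ , refl = cong suc (words-length n v∈)

words-unique : ∀ k n → Unique (words k n)
words-unique k zero    = All.[] ∷ []
words-unique k (suc n) =
  Unique.cartesianProductWith⁺ _∷_ (λ { refl → refl , refl })
    (Unique.allFin⁺ k) (words-unique k n)

rankB : Word k → ℕ
rankB {k} w =
  1 + length (filter (λ v → bordered? v ×-dec (v <ₗ? w)) (words k (length w)))

-- Unit-cost random access machine: unbounded integer registers R₀, R₁, R₂, …,
-- every instruction costs one time unit.

data Op : Set where
  add sub mul div mod : Op

data Instr : Set where
  const    : (dst : ℕ) (c : ℤ) → Instr
  copy     : (dst src : ℕ) → Instr
  arith    : (op : Op) (dst src₁ src₂ : ℕ) → Instr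
  load     : (dst ptr : ℕ) → Instr
  store    : (ptr src : ℕ) → Instr
  jump     : (target : ℕ) → Instr
  jumpZero : (src target : ℕ) → Instr
  jumpPos  : (src target : ℕ) → Instr
  halt     : Instr

Program : Set
Program = List Instr

Memory : Set
Memory = ℕ → ℤ

_[_≔_] : Memory → ℕ → ℤ → Memory
(m [ a ≔ v ]) x = if does (x ≟ a) then v else m x

infix 4 ⟨_,_⟩

record Config : Set where
  constructor ⟨_,_⟩
  field
    pc  : ℕ
    mem : Memory

fetch : Program → ℕ → Maybe Instr
fetch p pc = head (drop pc p)

⟦_⟧ : Op → ℤ → ℤ → Maybe ℤ
⟦ add ⟧ x y          = just (x ℤ.+ y)
⟦ sub ⟧ x y          = just (x ℤ.- y)
⟦ mul ⟧ x y          = just (x ℤ.* y)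
⟦ div ⟧ x (+ 0)      = nothing
⟦ div ⟧ x y@(+[1+ _ ]) = just (x ℤ./ y)
⟦ div ⟧ x y@(-[1+ _ ]) = just (x ℤ./ y)
⟦ mod ⟧ x (+ 0)      = nothing
⟦ mod ⟧ x y@(+[1+ _ ]) = just (+ (x ℤ.% y))
⟦ mod ⟧ x y@(-[1+ _ ]) = just (+ (x ℤ.% y))

address : ℤ → Maybe ℕ
address (+ a)    = just a
address -[1+ _ ] = nothing

-- `nothing` means that there is no successor: the machine has halted, divided
-- by zero, or used a negative address.
step : Instr → Config → Maybe Config
step (const d c)     ⟨ pc , m ⟩ = just ⟨ suc pc , m [ d ≔ c ] ⟩
step (copy d s)      ⟨ pc , m ⟩ = just ⟨ suc pc , m [ d ≔ m s ] ⟩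
step (arith op d s t) ⟨ pc , m ⟩ =
  Maybe.map (λ v → ⟨ suc pc , m [ d ≔ v ] ⟩) (⟦ op ⟧ (m s) (m t))
step (load d p)      ⟨ pc , m ⟩ =
  Maybe.map (λ a → ⟨ suc pc , m [ d ≔ m a ] ⟩) (address (m p))
step (store p s)     ⟨ pc , m ⟩ =
  Maybe.map (λ a → ⟨ suc pc , m [ a ≔ m s ] ⟩) (address (m p))
step (jump l)        ⟨ pc , m ⟩ = just ⟨ l , m ⟩
step (jumpZero s l)  ⟨ pc , m ⟩ with m s
... | + 0      = just ⟨ l , m ⟩
... | +[1+ _ ] = just ⟨ suc pc , m ⟩
... | -[1+ _ ] = just ⟨ suc pc , m ⟩
step (jumpPos s l)   ⟨ pc , m ⟩ with m s
... | + 0      = just ⟨ suc pc , m ⟩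
... | +[1+ _ ] = just ⟨ l , m ⟩
... | -[1+ _ ] = just ⟨ suc pc , m ⟩
step halt            _          = nothing

-- The registers read or written by an instruction.  A negative pointer makes
-- `step` fail, so ∣ m p ∣ is the address used whenever the step succeeds.
accessed : Instr → Memory → List ℕ
accessed (const d c)      m = d ∷ []
accessed (copy d s)       m = d ∷ s ∷ []
accessed (arith op d s t) m = d ∷ s ∷ t ∷ []
accessed (load d p)       m = d ∷ p ∷ ∣ m p ∣ ∷ []
accessed (store p s)      m = p ∷ s ∷ ∣ m p ∣ ∷ []
accessed (jump l)         m = []
accessed (jumpZero s l)   m = s ∷ []
accessed (jumpPos s l)    m = s ∷ []
accessed halt             m = []

-- One more than the largest index (0 for the empty list).
extent : List ℕ → ℕ
extent = foldr (λ a s → suc a ⊔ s) 0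

-- Run p c t s m: started in configuration c, the program p executes exactly t
-- instructions (the final `halt` included) and halts with memory m; s is the
-- least number such that only the registers R₀, …, R₍ₛ₋₁₎ are ever accessed.
data Run (p : Program) : Config → (time space : ℕ) → Memory → Set where
  halted : ∀ {pc m} → fetch p pc ≡ just halt → Run p ⟨ pc , m ⟩ 1 0 m
  _then_ : ∀ {pc m i c t s m′} →
           fetch p pc ≡ just i × step i ⟨ pc , m ⟩ ≡ just c →
           Run p c t s m′ →
           Run p ⟨ pc , m ⟩ (suc t) (extent (accessed i m) ⊔ s) m′

letterAt : Word k → ℕ → ℤ
letterAt []      _       = + 0
letterAt (x ∷ w) zero    = + suc (toℕ x)
letterAt (x ∷ w) (suc i) = letterAt w i

-- Input convention: R₀ = k, R₁ = |w|, R₂, R₃, … = the letters of w as numbers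
-- in {1,…,k}; every other register is 0.
input : Word k → Memory
input {k} w 0             = + k
input     w 1             = + length w
input     w (suc (suc i)) = letterAt w i

initial : Word k → Config
initial w = ⟨ 0 , input w ⟩

output : Memory → ℤ
output m = m 0

{-# OPTIONS --safe #-}
module Submission where

-- A bordered word has a unique unbordered border, its shortest one, and that border has at most
-- half its length.  Let y be a prefix of w and write y = w₁w₂w₃ with ∣w₁∣ = ∣w₃∣ = i.  A word below
-- y whose shortest border u has length i is u x u, and either u < w₁ with x arbitrary, or u = w₁
-- and x u < w₂w₃.  So, with U(w₁) the number of unbordered words below w₁ and val the rank of a
-- word among all words of its length, there are
--   U(w₁) k^∣w₂∣ + [w₁ unbordered] (val w₂ + [w₁ < w₃])
-- of them.  Summing over i gives the number of bordered words below y, hence U(y) = val y − that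
-- number, and y is unbordered iff no unbordered w₁ equals w₃.  Iterating over the prefixes of w
-- takes O(n²) instructions, because val w₁, val w₂ and val w₃ are quotients and remainders of val y.

open import Defs
open import Data.Bool.Base using (Bool; true; false; _∧_; if_then_else_) renaming (T to IsTrue)
open import Data.Empty using (⊥)
open import Data.Fin.Base as Fin using (Fin; zero; suc; toℕ)
import Data.Fin.Properties as Fin
open import Data.Integer.Base using (+_; -[1+_]; ∣_∣)
import Data.Integer.Properties as ℤ
open import Data.List.Base using (List; []; _∷_; _++_; length; map; filter; head; take; drop; allFin; tabulate; cartesianProductWith)
open import Data.List.Membership.Propositional using (_∈_)
open import Data.List.Membership.Propositional.Properties using (∈-allFin)
open import Data.List.Properties using (≡-dec; length-++; length-take; length-drop; take-take; take-all; drop-drop; take++drop≡id; map-∘; map-tabulate; ++-assoc; ++-identityʳ; ++-cancelˡ)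
open import Data.List.Relation.Binary.Lex.Core using (this; next)
open import Data.List.Relation.Binary.Pointwise as Pointwise using (Pointwise-≡⇒≡)
open import Data.List.Relation.Binary.Prefix.Heterogeneous as Prefix using (Prefix)
open import Data.List.Relation.Binary.Suffix.Heterogeneous as Suffix using (Suffix)
import Data.List.Relation.Unary.All as All
open import Data.List.Relation.Unary.Any using (here; there)
open import Data.List.Relation.Unary.Unique.Propositional using (Unique; _∷_)
open import Data.List.Relation.Unary.Unique.Propositional.Properties using (allFin⁺)
open import Data.Maybe.Base as Maybe using (just)
open import Data.Nat.Base
open import Data.Nat.DivMod using (_/_; _%_; m≡m%n+[m/n]*n; %-remove-+ˡ; m<n⇒m%n≡m; m*n/n≡m; /-monoˡ-≤; m/n≤m; m/n<m; m<n⇒m/n≡0; m≥n⇒m/n>0; +-distrib-/-∣ˡ)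
open import Data.Nat.Divisibility using (n∣m*n)
open import Data.Nat.Induction using (<-wellFounded)
open import Data.Nat.ListAction using (sum)
open import Data.Nat.Properties
open import Data.Nat.Tactic.RingSolver using (solve-∀)
open import Data.Product.Base using (Σ-syntax; ∃; _×_; _,_; proj₁; proj₂)
open import Data.Sum.Base using (_⊎_; inj₁; inj₂)
open import Data.Unit.Base using (⊤)
open import Data.Vec.Base as Vec using (Vec; []; _∷_)
open import Function.Base using (_∘_; id)
open import Induction.WellFounded using (Acc; acc)
open import Relation.Binary.Definitions using (tri<; tri≈; tri>)
open import Relation.Binary.PropositionalEquality
open import Relation.Nullary.Decidable using (Dec; yes; no; does; ¬?; _⊎-dec_; _×-dec_; dec-true; dec-false)
open import Relation.Nullary.Negation using (¬_; contradiction)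

-- The unbordered border is unique because the shorter of two borders is itself a border of the
-- longer one. Restricting to lengths i with 2i at most the length of y keeps the two outer blocks
-- disjoint, which makes the middle block a free digit string, and makes w₁ a proper prefix whose
-- count is already known.
--
-- On the machine the obstacles are case distinctions and space. The two comparisons of val w₁ with
-- val w₃ are therefore computed by integer division instead of jumps, so that a round of the inner
-- loop is one straight line of instructions. No intermediate value is negative, so the integer
-- machine can be followed with natural numbers. The count and the unborderedness bit of a prefix
-- are packed into one number that replaces the last letter of that prefix, so that word and table
-- share the same n registers. The powers of k are carried along and updated by one multiplication
-- or division per round. A register may hold a number close to k^n, which unit cost permits.

private
  variable
    k R : ℕ
    A B : Set

-- Indicators and finite sums

𝟙 : Dec A → ℕ
𝟙 d = if does d then 1 else 0

𝟙-yes : (d : Dec A) → A → 𝟙 d ≡ 1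
𝟙-yes d p rewrite dec-true d p = refl

𝟙-no : (d : Dec A) → ¬ A → 𝟙 d ≡ 0
𝟙-no d ¬p rewrite dec-false d ¬p = refl

𝟙-cong : (d : Dec A) (e : Dec B) → (A → B) → (B → A) → 𝟙 d ≡ 𝟙 e
𝟙-cong (yes p) e f g = sym (𝟙-yes e (f p))
𝟙-cong (no ¬p) e f g = sym (𝟙-no e (¬p ∘ g))

𝟙-× : (d : Dec A) (e : Dec B) → 𝟙 (d ×-dec e) ≡ 𝟙 d * 𝟙 e
𝟙-× (yes _) (yes _) = refl
𝟙-× (yes _) (no _)  = refl
𝟙-× (no _)  e       = refl

𝟙-¬ : (d : Dec A) → 𝟙 (¬? d) + 𝟙 d ≡ 1
𝟙-¬ (yes _) = refl
𝟙-¬ (no _)  = refl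

∑ : List A → (A → ℕ) → ℕ
∑ xs f = sum (map f xs)

∑-cong : ∀ (xs : List A) {f g : A → ℕ} → (∀ {x} → x ∈ xs → f x ≡ g x) → ∑ xs f ≡ ∑ xs g
∑-cong []       eq = refl
∑-cong (x ∷ xs) eq = cong₂ _+_ (eq (here refl)) (∑-cong xs (eq ∘ there))

∑-+ : ∀ (xs : List A) (f g : A → ℕ) → ∑ xs (λ x → f x + g x) ≡ ∑ xs f + ∑ xs g
∑-+ []       f g = refl
∑-+ (x ∷ xs) f g rewrite ∑-+ xs f g = lemma (f x) (g x) (∑ xs f) (∑ xs g)
  where
  lemma : ∀ a b c d → a + b + (c + d) ≡ a + c + (b + d)
  lemma = solve-∀

∑-*ˡ : ∀ c (xs : List A) (f : A → ℕ) → ∑ xs (λ x → c * f x) ≡ c * ∑ xs f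
∑-*ˡ c []       f = sym (*-zeroʳ c)
∑-*ˡ c (x ∷ xs) f rewrite ∑-*ˡ c xs f = sym (*-distribˡ-+ c (f x) (∑ xs f))

∑-*ʳ : ∀ c (xs : List A) (f : A → ℕ) → ∑ xs (λ x → f x * c) ≡ ∑ xs f * c
∑-*ʳ c []       f = refl
∑-*ʳ c (x ∷ xs) f rewrite ∑-*ʳ c xs f = sym (*-distribʳ-+ c (f x) (∑ xs f))

∑-0 : ∀ (xs : List A) {f : A → ℕ} → (∀ {x} → x ∈ xs → f x ≡ 0) → ∑ xs f ≡ 0
∑-0 []       eq = refl
∑-0 (x ∷ xs) eq rewrite eq (here refl) = ∑-0 xs (eq ∘ there)

-- Sifting with a Kronecker delta. It removes a block of letters that is forced to a single value,
-- either by the border equation or by agreement with the given word.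
∑-δ : ∀ {xs : List A} {u} (u≟_ : ∀ x → Dec (u ≡ x)) (f : A → ℕ) → Unique xs → u ∈ xs →
      ∑ xs (λ x → 𝟙 (u≟ x) * f x) ≡ f u
∑-δ {xs = x ∷ xs} u≟_ f (x∉ ∷ _) (here refl)
  rewrite 𝟙-yes (u≟ x) refl
        | ∑-0 xs {λ x → 𝟙 (u≟ x) * f x} (λ {y} y∈ → cong (_* f y) (𝟙-no (u≟ y) (All.lookup x∉ y∈)))
  = trans (+-identityʳ _) (+-identityʳ _)
∑-δ {xs = x ∷ xs} u≟_ f (x∉ ∷ uniq) (there u∈)
  rewrite 𝟙-no (u≟ x) (All.lookup x∉ u∈ ∘ sym) = ∑-δ u≟_ f uniq u∈

∑-++ : ∀ (xs ys : List A) (f : A → ℕ) → ∑ (xs ++ ys) f ≡ ∑ xs f + ∑ ys f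
∑-++ []       ys f = refl
∑-++ (x ∷ xs) ys f rewrite ∑-++ xs ys f = sym (+-assoc (f x) _ _)

∑-map : ∀ (g : A → B) (xs : List A) (f : B → ℕ) → ∑ (map g xs) f ≡ ∑ xs (f ∘ g)
∑-map g xs f = cong sum (sym (map-∘ xs))

∑-product : ∀ {C : Set} (g : A → B → C) xs ys (f : C → ℕ) →
            ∑ (cartesianProductWith g xs ys) f ≡ ∑ xs (λ x → ∑ ys (λ y → f (g x y)))
∑-product g []       ys f = refl
∑-product g (x ∷ xs) ys f =
  trans (∑-++ (map (g x) ys) _ f) (cong₂ _+_ (∑-map (g x) ys f) (∑-product g xs ys f))

length-filter≡∑ : ∀ {P : A → Set} (P? : ∀ x → Dec (P x)) xs →
                  length (filter P? xs) ≡ ∑ xs (λ x → 𝟙 (P? x))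
length-filter≡∑ P? []       = refl
length-filter≡∑ P? (x ∷ xs) with P? x
... | yes _ = cong suc (length-filter≡∑ P? xs)
... | no _  = length-filter≡∑ P? xs

_≟w_ : (u v : Word k) → Dec (u ≡ v)
_≟w_ = ≡-dec Fin._≟_

∑-words-++ : ∀ a b (f : Word k → ℕ) →
             ∑ (words k (a + b)) f ≡ ∑ (words k a) (λ u → ∑ (words k b) (λ v → f (u ++ v)))
∑-words-++ zero    b f = sym (+-identityʳ _)
∑-words-++ {k} (suc a) b f = begin
  ∑ (words k (suc a + b)) f
    ≡⟨ ∑-product _∷_ (allFin k) (words k (a + b)) f ⟩
  ∑ (allFin k) (λ x → ∑ (words k (a + b)) (λ v → f (x ∷ v)))
    ≡⟨ ∑-cong (allFin k) (λ {x} _ → ∑-words-++ a b (λ v → f (x ∷ v))) ⟩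
  ∑ (allFin k) (λ x → ∑ (words k a) (λ u → ∑ (words k b) (λ v → f (x ∷ u ++ v))))
    ≡⟨ ∑-product _∷_ (allFin k) (words k a) (λ u → ∑ (words k b) (λ v → f (u ++ v))) ⟨
  ∑ (words k (suc a)) (λ u → ∑ (words k b) (λ v → f (u ++ v))) ∎
  where open ≡-Reasoning

∑-tabulate : ∀ {n} (g : Fin n → A) (f : A → ℕ) → ∑ (tabulate g) f ≡ ∑ (allFin n) (f ∘ g)
∑-tabulate g f = trans (cong sum (map-tabulate g f)) (cong sum (sym (map-tabulate id (f ∘ g))))

∑-allFin-1 : ∀ n → ∑ (allFin n) (λ _ → 1) ≡ n
∑-allFin-1 zero    = refl
∑-allFin-1 (suc n) = cong suc (trans (∑-tabulate {n = n} suc (λ _ → 1)) (∑-allFin-1 n))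

∑-words-1 : ∀ n → ∑ (words k n) (λ _ → 1) ≡ k ^ n
∑-words-1 zero    = refl
∑-words-1 {k} (suc n) = begin
  ∑ (words k (suc n)) (λ _ → 1)                    ≡⟨ ∑-product _∷_ (allFin k) (words k n) _ ⟩
  ∑ (allFin k) (λ _ → ∑ (words k n) (λ _ → 1))     ≡⟨ ∑-cong (allFin k) (λ _ → trans (∑-words-1 n) (sym (*-identityˡ _))) ⟩
  ∑ (allFin k) (λ _ → 1 * k ^ n)                   ≡⟨ ∑-*ʳ (k ^ n) (allFin k) (λ _ → 1) ⟩
  ∑ (allFin k) (λ _ → 1) * k ^ n                   ≡⟨ cong (_* k ^ n) (∑-allFin-1 k) ⟩
  k * k ^ n                                        ∎
  where open ≡-Reasoning

∑-Fin-< : ∀ {n} (c : Fin n) → ∑ (allFin n) (λ a → 𝟙 (toℕ a <? toℕ c)) ≡ toℕ c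
∑-Fin-< {suc n} zero    = ∑-0 (allFin (suc n)) (λ {x} _ → 𝟙-no (toℕ x <? 0) λ ())
∑-Fin-< {suc n} (suc c) = cong suc (trans (∑-tabulate {n = n} suc (λ a → 𝟙 (toℕ a <? suc (toℕ c)))) (∑-Fin-< c))

-- Words as base-k numerals

val : Word k → ℕ
val []      = 0
val {k} (x ∷ w) = toℕ x * k ^ length w + val w

val-++ : ∀ (u v : Word k) → val (u ++ v) ≡ val u * k ^ length v + val v
val-++ []      v = refl
val-++ {k} (x ∷ u) v
  rewrite val-++ u v | length-++ u {v} | ^-distribˡ-+-* k (length u) (length v)
  = lemma (toℕ x) (k ^ length u) (k ^ length v) (val u) (val v)
  where
  lemma : ∀ a b c d e → a * (b * c) + (d * c + e) ≡ (a * b + d) * c + e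
  lemma = solve-∀

digit-bound : ∀ {a b x c} → a < b → x < c → a * c + x < b * c
digit-bound {a} {b} {x} {c} a<b x<c = begin-strict
  a * c + x  <⟨ +-monoʳ-< (a * c) x<c ⟩
  a * c + c  ≡⟨ +-comm (a * c) c ⟩
  suc a * c  ≤⟨ *-monoˡ-≤ c a<b ⟩
  b * c      ∎
  where open ≤-Reasoning

val<k^ : ∀ (w : Word k) → val w < k ^ length w
val<k^ []      = s≤s z≤n
val<k^ (x ∷ w) = digit-bound (Fin.toℕ<n x) (val<k^ w)

digits-< : ∀ {a b x y c} → a < b → x < c → a * c + x < b * c + y
digits-< {b = b} {c = c} a<b x<c = <-≤-trans (digit-bound a<b x<c) (m≤m+n (b * c) _)

-- The two ways to be smaller exclude each other, so their indicators add. In this polynomial form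
-- the comparison can be pulled apart under a sum over words.
𝟙-digits-< : ∀ {a b x y c} → x < c → y < c →
             𝟙 (a * c + x <? b * c + y) ≡ 𝟙 (a <? b) + 𝟙 (a ≟ b) * 𝟙 (x <? y)
𝟙-digits-< {a} {b} {x} {y} {c} x<c y<c with <-cmp a b
... | tri< a<b a≢b _ rewrite 𝟙-yes (a <? b) a<b | 𝟙-no (a ≟ b) a≢b =
  𝟙-yes (a * c + x <? b * c + y) (digits-< a<b x<c)
... | tri≈ a≮b refl _ rewrite 𝟙-no (a <? a) a≮b | 𝟙-yes (a ≟ a) refl =
  trans (𝟙-cong (a * c + x <? a * c + y) (x <? y) (+-cancelˡ-< (a * c) x y) (+-monoʳ-< (a * c)))
        (sym (+-identityʳ _))
... | tri> a≮b a≢b b<a rewrite 𝟙-no (a <? b) a≮b | 𝟙-no (a ≟ b) a≢b =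
  𝟙-no (a * c + x <? b * c + y) (<-asym (digits-< b<a y<c))

digits-injective : ∀ {a b x y c} → x < c → y < c → a * c + x ≡ b * c + y → a ≡ b × x ≡ y
digits-injective {a} {b} {c = c} x<c y<c eq with <-cmp a b
... | tri< a<b _ _  = contradiction eq (<⇒≢ (digits-< a<b x<c))
... | tri> _ _ b<a  = contradiction (sym eq) (<⇒≢ (digits-< b<a y<c))
... | tri≈ _ refl _ = refl , +-cancelˡ-≡ (a * c) _ _ eq

val-injective : ∀ (u v : Word k) → length u ≡ length v → val u ≡ val v → u ≡ v
val-injective []      []      _   _  = refl
val-injective {k} (x ∷ u) (y ∷ v) len eq
  with len′ ← suc-injective len
  with x≡y , u≡v ← digits-injective (subst (λ n → val u < k ^ n) len′ (val<k^ u)) (val<k^ v)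
                     (subst (λ n → toℕ x * k ^ n + val u ≡ toℕ y * k ^ length v + val v) len′ eq)
  = cong₂ _∷_ (Fin.toℕ-injective x≡y) (val-injective u v len′ u≡v)

𝟙-val-++-< : ∀ (u x u′ x′ : Word k) → length u ≡ length u′ → length x ≡ length x′ →
             𝟙 (val (u ++ x) <? val (u′ ++ x′)) ≡
             𝟙 (val u <? val u′) + 𝟙 (u′ ≟w u) * 𝟙 (val x <? val x′)
𝟙-val-++-< {k} u x u′ x′ |u| |x|
  rewrite val-++ u x | val-++ u′ x′ | |x|
        | 𝟙-cong (u′ ≟w u) (val u ≟ val u′) (λ eq → cong val (sym eq)) (λ eq → sym (val-injective u u′ |u| eq))
  = 𝟙-digits-< {val u} {val u′} (subst (λ n → val x < k ^ n) |x| (val<k^ x)) (val<k^ x′)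

<ₗ⇒val< : ∀ {u v : Word k} → length u ≡ length v → u <ₗ v → val u < val v
<ₗ⇒val< {u = x ∷ u} {y ∷ v} len (this x<y) rewrite suc-injective len =
  digits-< x<y (subst (λ n → val u < _ ^ n) (suc-injective len) (val<k^ u))
<ₗ⇒val< {u = x ∷ u} {.x ∷ v} len (next refl u<v) rewrite suc-injective len =
  +-monoʳ-< (toℕ x * _) (<ₗ⇒val< (suc-injective len) u<v)

val<⇒<ₗ : ∀ (u v : Word k) → length u ≡ length v → val u < val v → u <ₗ v
val<⇒<ₗ (x ∷ u) (y ∷ v) len lt with Fin.<-cmp x y
... | tri< x<y _ _  = this x<y
... | tri≈ _ refl _ rewrite suc-injective len =
  next refl (val<⇒<ₗ u v (suc-injective len) (+-cancelˡ-< (toℕ x * _) _ _ lt))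
... | tri> _ _ y<x  rewrite suc-injective len =
  contradiction lt (<-asym (digits-< y<x (val<k^ v)))

-- Borders

-- Trivially true for i = 0 and for i ≥ `length v`; the border lengths are the solutions strictly in
-- between.
Matches : ℕ → Word k → Set
Matches i v = take i v ≡ drop (length v ∸ i) v

matches? : ∀ i (v : Word k) → Dec (Matches i v)
matches? i v = take i v ≟w drop (length v ∸ i) v

-- For b < length v: v has a border of length at most b.
Short : ℕ → Word k → Set
Short zero    v = ⊥
Short (suc b) v = Matches (suc b) v ⊎ Short b v

short? : ∀ b (v : Word k) → Dec (Short b v)
short? zero    v = no λ ()
short? (suc b) v = matches? (suc b) v ⊎-dec short? b v

short⁺ : ∀ {i b} {v : Word k} → 1 ≤ i → i ≤ b → Matches i v → Short b v
short⁺ {i = suc i} {zero}  _   ()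
short⁺ {i = suc i} {suc b} 1≤i i≤b match with m≤n⇒m<n∨m≡n i≤b
... | inj₁ (s≤s i<b) = inj₂ (short⁺ 1≤i i<b match)
... | inj₂ refl      = inj₁ match

short⁻ : ∀ b {v : Word k} → Short b v → Σ[ i ∈ ℕ ] (1 ≤ i × i ≤ b × Matches i v)
short⁻ (suc b) (inj₁ match) = suc b , s≤s z≤n , ≤-refl , match
short⁻ (suc b) (inj₂ short) with i , 1≤i , i≤b , match ← short⁻ b short =
  i , 1≤i , m≤n⇒m≤1+n i≤b , match

bord : Word k → ℕ
bord v = 𝟙 (short? (pred (length v)) v)

unb : Word k → ℕ
unb v = 𝟙 (¬? (short? (pred (length v)) v))

module _ (v : Word k) {j} (j≤ : j ≤ length v) (match : Matches j v) where

  private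
    u : Word k
    u = take j v

    |u| : length u ≡ j
    |u| = trans (length-take j v) (m≤n⇒m⊓n≡m j≤)

    take-u : ∀ {i} → i ≤ j → take i u ≡ take i v
    take-u {i} i≤j = trans (take-take i j v) (cong (λ n → take n v) (m≤n⇒m⊓n≡m i≤j))

    drop-u : ∀ {i} → i ≤ j → drop (length u ∸ i) u ≡ drop (length v ∸ i) v
    drop-u {i} i≤j = begin
      drop (length u ∸ i) u                      ≡⟨ cong (λ n → drop (n ∸ i) u) |u| ⟩
      drop (j ∸ i) u                             ≡⟨ cong (drop (j ∸ i)) match ⟩
      drop (j ∸ i) (drop (length v ∸ j) v)       ≡⟨ drop-drop (length v ∸ j) (j ∸ i) v ⟩
      drop ((length v ∸ j) + (j ∸ i)) v          ≡⟨ cong (λ n → drop n v) (+-∸-assoc (length v ∸ j) i≤j) ⟨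
      drop ((length v ∸ j) + j ∸ i) v            ≡⟨ cong (λ n → drop (n ∸ i) v) (m∸n+n≡m j≤) ⟩
      drop (length v ∸ i) v                      ∎
      where open ≡-Reasoning

  -- By `match`, `u` is a suffix of `v` as well as a prefix, so for i ≤ j the prefix and the suffix
  -- of length i are the same words in `u` as in `v`.
  short-take⁺ : ∀ b → b ≤ j → Short b v → Short b (take j v)
  short-take⁺ (suc b) b<j (inj₁ m) = inj₁ (trans (take-u b<j) (trans m (sym (drop-u b<j))))
  short-take⁺ (suc b) b<j (inj₂ s) = inj₂ (short-take⁺ b (<⇒≤ b<j) s)

  short-take⁻ : ∀ b → b ≤ j → Short b (take j v) → Short b v
  short-take⁻ (suc b) b<j (inj₁ m) = inj₁ (trans (sym (take-u b<j)) (trans m (drop-u b<j)))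
  short-take⁻ (suc b) b<j (inj₂ s) = inj₂ (short-take⁻ b (<⇒≤ b<j) s)

-- If the prefix of length suc b matches, its borders are the borders of v of length at most b.
𝟙-short-suc : ∀ b (v : Word k) → suc b ≤ length v →
              𝟙 (short? (suc b) v) ≡ 𝟙 (short? b v) + unb (take (suc b) v) * 𝟙 (matches? (suc b) v)
𝟙-short-suc b v b< with matches? (suc b) v
... | no _ rewrite *-zeroʳ (unb (take (suc b) v)) = sym (+-identityʳ _)
... | yes match
  -- The prefix has length `suc b`, so its `unb` inspects lengths up to `b`, and there it agrees
  -- with `v`. The left side is 1, and the right side is an indicator plus its complement.
  rewrite length-take (suc b) v | m≤n⇒m⊓n≡m b<
        | 𝟙-cong (¬? (short? b (take (suc b) v))) (¬? (short? b v))
            (_∘ short-take⁺ v b< match b (n≤1+n b)) (_∘ short-take⁻ v b< match b (n≤1+n b))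
        | *-identityʳ (𝟙 (¬? (short? b v)))
  = sym (trans (+-comm (𝟙 (short? b v)) _) (𝟙-¬ (short? b v)))

take-length-++ : ∀ (xs : List A) {ys} → take (length xs) (xs ++ ys) ≡ xs
take-length-++ []       = refl
take-length-++ (x ∷ xs) = cong (x ∷_) (take-length-++ xs)

drop-length-++ : ∀ (xs : List A) {ys} → drop (length xs) (xs ++ ys) ≡ ys
drop-length-++ []       = refl
drop-length-++ (x ∷ xs) = drop-length-++ xs

length-++-∸ : ∀ (xs ys : List A) → length (xs ++ ys) ∸ length ys ≡ length xs
length-++-∸ xs ys = trans (cong (_∸ length ys) (length-++ xs)) (m+n∸n≡m (length xs) (length ys))

matches⁺ : ∀ (u x y : Word k) {v} → v ≡ u ++ y → v ≡ x ++ u → Matches (length u) v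
matches⁺ u x y {v} v≡uy v≡xu = begin
  take (length u) v               ≡⟨ cong (take (length u)) v≡uy ⟩
  take (length u) (u ++ y)        ≡⟨ take-length-++ u ⟩
  u                               ≡⟨ drop-length-++ x ⟨
  drop (length x) (x ++ u)        ≡⟨ cong (λ n → drop n (x ++ u)) (length-++-∸ x u) ⟨
  drop (length (x ++ u) ∸ length u) (x ++ u) ≡⟨ cong (λ z → drop (length z ∸ length u) z) v≡xu ⟨
  drop (length v ∸ length u) v    ∎
  where open ≡-Reasoning

-- One half of Levi's lemma on two factorisations of the same word.
++-split : ∀ (x u : List A) {r s} → x ++ r ≡ u ++ s → length x ≤ length u → ∃ λ t → u ≡ x ++ t
++-split []      u       eq len       = u , refl
++-split (a ∷ x) (b ∷ u) eq (s≤s len) with refl ← cong (take 1) eq =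
  let t , u≡ = ++-split x u (cong (drop 1) eq) len in t , cong (a ∷_) u≡

-- A border longer than half the word overlaps itself, and the overlap is a shorter border.
short-border : ∀ (x u y : Word k) → Acc _<_ (length u) → x ++ u ≡ u ++ y → 1 ≤ length x → 1 ≤ length u →
               Σ[ u′ ∈ Word k ] Σ[ x′ ∈ Word k ] Σ[ y′ ∈ Word k ]
                 (x ++ u ≡ u′ ++ y′ × x ++ u ≡ x′ ++ u′ × 1 ≤ length u′ × length u′ + length u′ ≤ length (x ++ u))
short-border x u y (acc rs) eq 1≤x 1≤u with length u ≤? length x
... | yes u≤x = u , x , y , eq , refl , 1≤u
              , subst (length u + length u ≤_) (sym (length-++ x)) (+-monoˡ-≤ (length u) u≤x)
-- Here u = x t, and cancelling x in x x t = x t y leaves the same equation with `t` in place of u.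
-- A border found for x t = u is a border of x u, since u is both a prefix and a suffix of it.
... | no u≰x with t , refl ← ++-split x u eq (<⇒≤ (≰⇒> u≰x)) =
  let u′ , x′ , y′ , w≡u′y′ , w≡x′u′ , 1≤u′ , 2u′≤ = short-border x t y (rs t<) eq′ 1≤x 1≤t
  in u′ , x ++ x′ , y′ ++ y
   , trans eq (trans (cong (_++ y) w≡u′y′) (++-assoc u′ y′ y))
   , trans (cong (x ++_) w≡x′u′) (sym (++-assoc x x′ u′))
   , 1≤u′
   , ≤-trans 2u′≤ (subst (length (x ++ t) ≤_) (sym (length-++ x)) (m≤n+m _ _))
  where
  t< : length t < length (x ++ t)
  t< = subst (length t <_) (sym (length-++ x)) (m<n+m (length t) 1≤x)
  1≤t : 1 ≤ length t
  1≤t = +-cancelˡ-< (length x) 0 (length t)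
          (subst₂ _<_ (sym (+-identityʳ _)) (length-++ x) (≰⇒> u≰x))
  eq′ : x ++ t ≡ t ++ y
  eq′ = ++-cancelˡ x _ _ (trans eq (++-assoc x t y))

double≤⇒≤half : ∀ {i n} → i + i ≤ n → i ≤ n / 2
double≤⇒≤half {i} {n} i+i≤n = begin
  i          ≡⟨ m*n/n≡m i 2 ⟨
  i * 2 / 2  ≤⟨ /-monoˡ-≤ 2 (subst (_≤ n) (lemma i) i+i≤n) ⟩
  n / 2      ∎
  where
  open ≤-Reasoning
  lemma : ∀ i → i + i ≡ i * 2
  lemma = solve-∀

half≤pred : ∀ n → n / 2 ≤ pred n
half≤pred zero    = z≤n
half≤pred (suc n) = s≤s⁻¹ (m/n<m (suc n) 2 ≤-refl)

short-mono : ∀ {b c} {v : Word k} → b ≤ c → Short b v → Short c v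
short-mono {b = b} b≤c s with i , 1≤i , i≤b , m ← short⁻ b s = short⁺ 1≤i (≤-trans i≤b b≤c) m

-- Any border is replaced by one that does not overlap itself, through `short-border`. Hence the
-- search over lengths may stop at half the word.
short-half : ∀ (v : Word k) → Short (pred (length v)) v → Short (length v / 2) v
short-half v s
  with i , 1≤i , i≤ , match ← short⁻ _ s
  = let u′ , x′ , y′ , v≡u′y′ , v≡x′u′ , 1≤u′ , 2u′≤ =
          short-border x u (drop i v) (<-wellFounded _) (trans v≡xu (sym (take++drop≡id i v))) 1≤x 1≤u
    in short⁺ 1≤u′ (double≤⇒≤half (subst (λ z → length u′ + length u′ ≤ length z) v≡xu 2u′≤))
         (matches⁺ u′ x′ y′ (trans (sym v≡xu) v≡u′y′) (trans (sym v≡xu) v≡x′u′))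
  where
  u x : Word _
  u = take i v
  x = take (length v ∸ i) v
  v≡xu : x ++ u ≡ v
  v≡xu = trans (cong (x ++_) match) (take++drop≡id (length v ∸ i) v)
  1≤v : 1 ≤ length v
  1≤v = ≤-trans 1≤i (≤-trans i≤ pred[n]≤n)
  i<v : i < length v
  i<v = subst (i <_) (suc-pred (length v) {{>-nonZero 1≤v}}) (s≤s i≤)
  1≤u : 1 ≤ length u
  1≤u = subst (1 ≤_) (sym (trans (length-take i v) (m≤n⇒m⊓n≡m (<⇒≤ i<v)))) 1≤i
  1≤x : 1 ≤ length x
  1≤x = subst (1 ≤_) (sym (trans (length-take _ v) (m≤n⇒m⊓n≡m (m∸n≤m (length v) i)))) (m<n⇒0<n∸m i<v)

𝟙-short-half : ∀ (v : Word k) → 𝟙 (short? (length v / 2) v) ≡ bord v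
𝟙-short-half v = 𝟙-cong (short? _ v) (short? _ v) (short-mono (half≤pred (length v))) (short-half v)

length≡0 : ∀ (xs : List A) → length xs ≡ 0 → xs ≡ []
length≡0 [] _ = refl

bordered⇒short : ∀ {v : Word k} → Bordered v → Short (pred (length v)) v
bordered⇒short {v = v} (u , u≢[] , u≢v , pre , suf) =
  short⁺ 1≤u (<⇒≤pred u<v) (matches⁺ u (proj₁ suffix) (proj₁ prefix) v≡uy v≡xu)
  where
  prefix : ∃ λ y → v ≡ u ++ y
  prefix with Prefix.toView pre
  ... | eq Prefix.++ y = y , cong (_++ y) (sym (Pointwise-≡⇒≡ eq))
  suffix : ∃ λ x → v ≡ x ++ u
  suffix with Suffix.toView suf
  ... | x Suffix.++ eq = x , cong (x ++_) (sym (Pointwise-≡⇒≡ eq))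
  v≡uy = proj₂ prefix
  v≡xu = proj₂ suffix
  1≤u : 1 ≤ length u
  1≤u = n≢0⇒n>0 (u≢[] ∘ length≡0 u)
  u<v : length u < length v
  u<v with proj₁ prefix | v≡uy
  ... | []    | eq = contradiction (sym (trans eq (++-identityʳ u))) u≢v
  ... | _ ∷ y | eq = subst (length u <_) (sym (trans (cong length eq) (length-++ u))) (m<m+n (length u) (s≤s z≤n))

short⇒bordered : ∀ {v : Word k} → Short (pred (length v)) v → Bordered v
short⇒bordered {v = v} s
  with i , 1≤i , i≤ , match ← short⁻ _ s
  = take i v , ne , neq , pre , suf
  where
  1≤v : 1 ≤ length v
  1≤v = ≤-trans 1≤i (≤-trans i≤ pred[n]≤n)
  i<v : i < length v
  i<v = subst (i <_) (suc-pred (length v) {{>-nonZero 1≤v}}) (s≤s i≤)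
  |u| : length (take i v) ≡ i
  |u| = trans (length-take i v) (m≤n⇒m⊓n≡m (<⇒≤ i<v))
  ne : take i v ≢ []
  ne eq = <⇒≢ 1≤i (trans (sym (cong length eq)) |u|)
  neq : take i v ≢ v
  neq eq = <⇒≢ i<v (trans (sym |u|) (cong length eq))
  pre : Prefix _≡_ (take i v) v
  pre = subst (Prefix _≡_ (take i v)) (take++drop≡id i v) (Prefix.fromView (Pointwise.refl refl Prefix.++ drop i v))
  suf : Suffix _≡_ (take i v) v
  suf = subst (Suffix _≡_ (take i v)) (take++drop≡id (length v ∸ i) v)
          (Suffix.fromView (take (length v ∸ i) v Suffix.++ Pointwise.≡⇒Pointwise-≡ match))

-- Counting smaller words

-- Comparing by `val` instead of lexicographically opens the sum to digit arithmetic; a general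
-- weight `f` makes it linear, so that all words, bordered words and words with one given border
-- length are instances.
below : Word k → (Word k → ℕ) → ℕ
below {k} y f = ∑ (words k (length y)) (λ v → 𝟙 (val v <? val y) * f v)

-- Each of the `toℕ a` smaller first letters leaves the tail free, and the letter `a` itself leaves
-- the same count for the tail.
below-1 : ∀ (y : Word k) → below y (λ _ → 1) ≡ val y
below-1 []      = refl
below-1 {k} (a ∷ y) = begin
  below (a ∷ y) (λ _ → 1)
    ≡⟨ ∑-product _∷_ (allFin k) W _ ⟩
  ∑ (allFin k) (λ x → ∑ W (λ v → 𝟙 (val (x ∷ v) <? val (a ∷ y)) * 1))
    ≡⟨ ∑-cong (allFin k) (λ {x} _ → inner x) ⟩
  ∑ (allFin k) (λ x → 𝟙 (toℕ x <? toℕ a) * k ^ length y + 𝟙 (a Fin.≟ x) * val y)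
    ≡⟨ ∑-+ (allFin k) _ _ ⟩
  ∑ (allFin k) (λ x → 𝟙 (toℕ x <? toℕ a) * k ^ length y) + ∑ (allFin k) (λ x → 𝟙 (a Fin.≟ x) * val y)
    ≡⟨ cong₂ _+_ (trans (∑-*ʳ (k ^ length y) (allFin k) _) (cong (_* k ^ length y) (∑-Fin-< a)))
                 (∑-δ (a Fin.≟_) (λ _ → val y) (allFin⁺ k) (∈-allFin a)) ⟩
  val (a ∷ y) ∎
  where
  open ≡-Reasoning
  W = words k (length y)

  summand : ∀ x {v} → v ∈ W →
            𝟙 (val (x ∷ v) <? val (a ∷ y)) * 1 ≡
            𝟙 (toℕ x <? toℕ a) * 1 + 𝟙 (a Fin.≟ x) * (𝟙 (val v <? val y) * 1)
  summand x {v} v∈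
    rewrite words-length (length y) v∈
          | 𝟙-digits-< {toℕ x} {toℕ a} (subst (λ n → val v < k ^ n) (words-length (length y) v∈) (val<k^ v)) (val<k^ y)
          | 𝟙-cong (toℕ x ≟ toℕ a) (a Fin.≟ x) (sym ∘ Fin.toℕ-injective) (cong toℕ ∘ sym)
    = lemma (𝟙 (toℕ x <? toℕ a)) (𝟙 (a Fin.≟ x)) (𝟙 (val v <? val y))
    where
    lemma : ∀ p q r → (p + q * r) * 1 ≡ p * 1 + q * (r * 1)
    lemma = solve-∀

  inner : ∀ x → ∑ W (λ v → 𝟙 (val (x ∷ v) <? val (a ∷ y)) * 1) ≡
                𝟙 (toℕ x <? toℕ a) * k ^ length y + 𝟙 (a Fin.≟ x) * val y
  inner x = begin
    ∑ W (λ v → 𝟙 (val (x ∷ v) <? val (a ∷ y)) * 1)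
      ≡⟨ ∑-cong W (summand x) ⟩
    ∑ W (λ v → 𝟙 (toℕ x <? toℕ a) * 1 + 𝟙 (a Fin.≟ x) * (𝟙 (val v <? val y) * 1))
      ≡⟨ ∑-+ W _ _ ⟩
    ∑ W (λ v → 𝟙 (toℕ x <? toℕ a) * 1) + ∑ W (λ v → 𝟙 (a Fin.≟ x) * (𝟙 (val v <? val y) * 1))
      ≡⟨ cong₂ _+_ (trans (∑-*ˡ (𝟙 (toℕ x <? toℕ a)) W _) (cong (𝟙 (toℕ x <? toℕ a) *_) (∑-words-1 (length y))))
                   (trans (∑-*ˡ (𝟙 (a Fin.≟ x)) W _) (cong (𝟙 (a Fin.≟ x) *_) (below-1 y))) ⟩
    𝟙 (toℕ x <? toℕ a) * k ^ length y + 𝟙 (a Fin.≟ x) * val y ∎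

below-cong : ∀ (y : Word k) {f g : Word k → ℕ} → (∀ v → length v ≡ length y → f v ≡ g v) → below y f ≡ below y g
below-cong {k} y eq = ∑-cong (words k (length y)) (λ {v} v∈ → cong (𝟙 (val v <? val y) *_) (eq v (words-length _ v∈)))

below-+ : ∀ (y : Word k) (f g : Word k → ℕ) → below y (λ v → f v + g v) ≡ below y f + below y g
below-+ {k} y f g =
  trans (∑-cong (words k (length y)) (λ {v} _ → *-distribˡ-+ (𝟙 (val v <? val y)) (f v) (g v)))
        (∑-+ (words k (length y)) _ _)

rankB≡ : ∀ (w : Word k) → rankB w ≡ 1 + below w bord
rankB≡ {k} w = cong suc (begin
  length (filter (λ v → bordered? v ×-dec (v <ₗ? w)) W)  ≡⟨ length-filter≡∑ _ W ⟩
  ∑ W (λ v → 𝟙 (bordered? v ×-dec (v <ₗ? w)))            ≡⟨ ∑-cong W (λ {v} v∈ → summand v (words-length (length w) v∈)) ⟩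
  below w bord ∎)
  where
  open ≡-Reasoning
  W = words k (length w)
  summand : ∀ v → length v ≡ length w → 𝟙 (bordered? v ×-dec (v <ₗ? w)) ≡ 𝟙 (val v <? val w) * bord v
  summand v |v| = begin
    𝟙 (bordered? v ×-dec (v <ₗ? w))  ≡⟨ 𝟙-× (bordered? v) (v <ₗ? w) ⟩
    𝟙 (bordered? v) * 𝟙 (v <ₗ? w)    ≡⟨ cong₂ _*_ (𝟙-cong (bordered? v) (short? _ v) bordered⇒short short⇒bordered)
                                                   (𝟙-cong (v <ₗ? w) (val v <? val w) (<ₗ⇒val< |v|) (val<⇒<ₗ v w |v|)) ⟩
    bord v * 𝟙 (val v <? val w)      ≡⟨ *-comm (bord v) _ ⟩
    𝟙 (val v <? val w) * bord v      ∎

below-unb+bord : ∀ (y : Word k) → below y unb + below y bord ≡ val y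
below-unb+bord y = trans (sym (below-+ y unb bord)) (trans (below-cong y (λ v _ → 𝟙-¬ (short? (pred (length v)) v))) (below-1 y))

-- Words with the border u of length ∣w₁∣ have the form u x u.
below-border : ∀ (w₁ w₂ w₃ : Word k) → length w₃ ≡ length w₁ →
               below (w₁ ++ w₂ ++ w₃) (λ v → unb (take (length w₁) v) * 𝟙 (matches? (length w₁) v)) ≡
               below w₁ unb * k ^ length w₂ + unb w₁ * (val w₂ + 𝟙 (val w₁ <? val w₃))
below-border {k} w₁ w₂ w₃ |w₃| = begin
  below y f
    ≡⟨ cong (λ n → ∑ (words k n) F) (trans (length-++ w₁) (cong (_+_ (length w₁)) (trans (length-++ w₂) (cong (_+_ (length w₂)) |w₃|)))) ⟩
  ∑ (words k (i + (m + i))) F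
    ≡⟨ ∑-words-++ i (m + i) F ⟩
  ∑ I (λ u → ∑ (words k (m + i)) (λ v → F (u ++ v)))
    ≡⟨ ∑-cong I (λ {u} _ → ∑-words-++ m i (λ v → F (u ++ v))) ⟩
  ∑ I (λ u → ∑ M (λ x → ∑ I (λ z → F (u ++ x ++ z))))
    ≡⟨ ∑-cong I (λ {u} u∈ → trans (∑-cong M (λ {x} x∈ → sum-z u∈ x∈)) (sum-x u)) ⟩
  ∑ I (λ u → (𝟙 (val u <? val w₁) * unb u) * k ^ m + 𝟙 (w₁ ≟w u) * (unb u * (val w₂ + 𝟙 (val u <? val w₃))))
    ≡⟨ ∑-+ I _ _ ⟩
  ∑ I (λ u → (𝟙 (val u <? val w₁) * unb u) * k ^ m) + ∑ I (λ u → 𝟙 (w₁ ≟w u) * (unb u * (val w₂ + 𝟙 (val u <? val w₃))))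
    ≡⟨ cong₂ _+_ (∑-*ʳ (k ^ m) I _) (∑-δ (w₁ ≟w_) (λ u → unb u * (val w₂ + 𝟙 (val u <? val w₃))) (words-unique k i) (words-complete w₁)) ⟩
  below w₁ unb * k ^ m + unb w₁ * (val w₂ + 𝟙 (val w₁ <? val w₃)) ∎
  where
  open ≡-Reasoning
  y = w₁ ++ w₂ ++ w₃
  i = length w₁
  m = length w₂
  I = words k i
  M = words k m
  f : Word k → ℕ
  f v = unb (take i v) * 𝟙 (matches? i v)
  F : Word k → ℕ
  F v = 𝟙 (val v <? val y) * f v

  -- The comparison of u x z with w₁ w₂ w₃ block by block, weighted by `unb u`.
  G : Word k → Word k → Word k → ℕ
  G u x z = (𝟙 (val u <? val w₁) + 𝟙 (w₁ ≟w u) * (𝟙 (val x <? val w₂) + 𝟙 (w₂ ≟w x) * 𝟙 (val z <? val w₃))) * unb u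

  f≡ : ∀ u x z → length u ≡ i → length z ≡ i → f (u ++ x ++ z) ≡ unb u * 𝟙 (u ≟w z)
  f≡ u x z |u| |z| = cong₂ _*_ (cong unb take≡)
    (𝟙-cong (matches? i (u ++ x ++ z)) (u ≟w z)
      (λ eq → trans (sym take≡) (trans eq drop≡)) (λ eq → trans take≡ (trans eq (sym drop≡))))
    where
    take≡ : take i (u ++ x ++ z) ≡ u
    take≡ = trans (cong (λ n → take n (u ++ x ++ z)) (sym |u|)) (take-length-++ u)
    drop≡ : drop (length (u ++ x ++ z) ∸ i) (u ++ x ++ z) ≡ z
    drop≡ rewrite sym (++-assoc u x z) | sym |z| | length-++-∸ (u ++ x) z = drop-length-++ (u ++ x)

  F≡ : ∀ u x z → length u ≡ i → length x ≡ m → length z ≡ i →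
       F (u ++ x ++ z) ≡ 𝟙 (u ≟w z) * G u x z
  F≡ u x z |u| |x| |z|
    rewrite f≡ u x z |u| |z|
          | 𝟙-val-++-< u (x ++ z) w₁ (w₂ ++ w₃) |u|
              (trans (length-++ x) (trans (cong₂ _+_ |x| (trans |z| (sym |w₃|))) (sym (length-++ w₂))))
          | 𝟙-val-++-< x z w₂ w₃ |x| (trans |z| (sym |w₃|))
    = lemma (𝟙 (val u <? val w₁) + 𝟙 (w₁ ≟w u) * (𝟙 (val x <? val w₂) + 𝟙 (w₂ ≟w x) * 𝟙 (val z <? val w₃)))
            (unb u) (𝟙 (u ≟w z))
    where
    lemma : ∀ a b c → a * (b * c) ≡ c * (a * b)
    lemma = solve-∀

  -- The border equation allows only z = u, so the last block disappears from the sum.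
  sum-z : ∀ {u x} → u ∈ I → x ∈ M → ∑ I (λ z → F (u ++ x ++ z)) ≡ G u x u
  sum-z {u} {x} u∈ x∈ =
    trans (∑-cong I (λ {z} z∈ → F≡ u x z (words-length i u∈) (words-length m x∈) (words-length i z∈)))
          (∑-δ (u ≟w_) (G u x) (words-unique k i) u∈)

  -- If u is below w₁, every x counts. If u = w₁, those x below w₂ count, and x = w₂ counts
  -- precisely when u is below w₃.
  sum-x : ∀ u → ∑ M (λ x → G u x u) ≡
          (𝟙 (val u <? val w₁) * unb u) * k ^ m + 𝟙 (w₁ ≟w u) * (unb u * (val w₂ + 𝟙 (val u <? val w₃)))
  sum-x u = begin
    ∑ M (λ x → G u x u)
      ≡⟨ ∑-cong M (λ {x} _ → lemma a c b (𝟙 (val x <? val w₂)) (𝟙 (w₂ ≟w x)) d) ⟩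
    ∑ M (λ x → a * b * 1 + c * b * (𝟙 (val x <? val w₂) * 1 + 𝟙 (w₂ ≟w x) * d))
      ≡⟨ ∑-+ M _ _ ⟩
    ∑ M (λ x → a * b * 1) + ∑ M (λ x → c * b * (𝟙 (val x <? val w₂) * 1 + 𝟙 (w₂ ≟w x) * d))
      ≡⟨ cong₂ _+_ (trans (∑-*ˡ (a * b) M _) (cong (a * b *_) (∑-words-1 m)))
                   (trans (∑-*ˡ (c * b) M _) (cong (c * b *_) (trans (∑-+ M _ _)
                     (cong₂ _+_ (below-1 w₂) (∑-δ (w₂ ≟w_) (λ _ → d) (words-unique k m) (words-complete w₂)))))) ⟩
    a * b * k ^ m + c * b * (val w₂ + d)
      ≡⟨ cong (_+_ (a * b * k ^ m)) (*-assoc c b _) ⟩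
    a * b * k ^ m + c * (b * (val w₂ + d)) ∎
    where
    a = 𝟙 (val u <? val w₁)
    b = unb u
    c = 𝟙 (w₁ ≟w u)
    d = 𝟙 (val u <? val w₃)
    lemma : ∀ a c b p q d → (a + c * (p + q * d)) * b ≡ a * b * 1 + c * b * (p * 1 + q * d)
    lemma = solve-∀

-- Straight-line execution over the natural numbers

infixl 7 _÷_ _rem_

-- Total, with value 0 for divisor 0, so that `exec` is a plain function; `Defined` is what ties it
-- to the machine, whose division by zero fails.
_÷_ : ℕ → ℕ → ℕ
m ÷ zero  = 0
m ÷ suc n = m / suc n

_rem_ : ℕ → ℕ → ℕ
m rem zero  = 0
m rem suc n = m % suc n

Heap : Set
Heap = ℕ → ℕ

infixl 8 _⟨_↦_⟩

_⟨_↦_⟩ : Heap → ℕ → ℕ → Heap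
(h ⟨ a ↦ v ⟩) x = if does (x ≟ a) then v else h x

-- The registers below R are listed; register R + x is cell x of the heap.
record State (R : ℕ) : Set where
  constructor _∥_
  field
    regs : Vec ℕ R
    heap : Heap

infix 4 _∥_

peekV : Vec ℕ R → Heap → ℕ → ℕ
peekV []       h a       = h a
peekV (x ∷ xs) h zero    = x
peekV (x ∷ xs) h (suc a) = peekV xs h a

pokeV : Vec ℕ R → ℕ → ℕ → Vec ℕ R
pokeV []       a       v = []
pokeV (x ∷ xs) zero    v = v ∷ xs
pokeV (x ∷ xs) (suc a) v = x ∷ pokeV xs a v

pokeH : ℕ → Heap → ℕ → ℕ → Heap
pokeH zero    h a       v = h ⟨ a ↦ v ⟩
pokeH (suc R) h zero    v = h
pokeH (suc R) h (suc a) v = pokeH R h a v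

peek : State R → ℕ → ℕ
peek (xs ∥ h) = peekV xs h

poke : State R → ℕ → ℕ → State R
poke {R} (xs ∥ h) a v = pokeV xs a v ∥ pokeH R h a v

peek-poke : ∀ (xs : Vec ℕ R) h a v x →
            peekV (pokeV xs a v) (pokeH R h a v) x ≡ (if does (x ≟ a) then v else peekV xs h x)
peek-poke []       h a       v x       = refl
peek-poke (y ∷ xs) h zero    v zero    = refl
peek-poke (y ∷ xs) h zero    v (suc x) = refl
peek-poke (y ∷ xs) h (suc a) v zero    = refl
peek-poke (y ∷ xs) h (suc a) v (suc x) = peek-poke xs h a v x

infix 4 _≈_

record _≈_ (m : Memory) (s : State R) : Set where
  constructor represents
  field
    at : ∀ a → m a ≡ + peek s a

open _≈_

≈-poke : ∀ {m} {s : State R} {v v′} a → m ≈ s → v ≡ + v′ → m [ a ≔ v ] ≈ poke s a v′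
≈-poke {m = m} {xs ∥ h} {v} {v′} a m≈s v≡ = represents lemma
  where
  lemma : ∀ x → (m [ a ≔ v ]) x ≡ + peek (poke (xs ∥ h) a v′) x
  lemma x rewrite peek-poke xs h a v′ x with does (x ≟ a)
  ... | true  = v≡
  ... | false = m≈s .at x

⟦_⟧ₙ : Op → ℕ → ℕ → ℕ
⟦ add ⟧ₙ x y = x + y
⟦ sub ⟧ₙ x y = x ∸ y
⟦ mul ⟧ₙ x y = x * y
⟦ div ⟧ₙ x y = x ÷ y
⟦ mod ⟧ₙ x y = x rem y

Defined : Op → ℕ → ℕ → Set
Defined add x y = ⊤
Defined sub x y = y ≤ x
Defined mul x y = ⊤
Defined div x y = NonZero y
Defined mod x y = NonZero y

⟦⟧-correct : ∀ op x y → Defined op x y → ⟦ op ⟧ (+ x) (+ y) ≡ just (+ ⟦ op ⟧ₙ x y)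
⟦⟧-correct add x y       _   = refl
⟦⟧-correct sub x y       y≤x = cong just (trans (ℤ.m-n≡m⊖n x y) (ℤ.⊖-≥ y≤x))
⟦⟧-correct mul x y       _   = cong just (sym (ℤ.pos-* x y))
⟦⟧-correct div x (suc y) _   = cong just (ℤ.*-identityˡ (+ (x / suc y)))
⟦⟧-correct mod x (suc y) _   = refl

-- Jumps, `halt` and negative constants get a dummy meaning here; `Safe₁` is empty for them.
exec₁ : Instr → State R → State R
exec₁ (const d (+ c))    s = poke s d c
exec₁ (copy d a)         s = poke s d (peek s a)
exec₁ (arith op d a b)   s = poke s d (⟦ op ⟧ₙ (peek s a) (peek s b))
exec₁ (load d p)         s = poke s d (peek s (peek s p))
exec₁ (store p a)        s = poke s (peek s p) (peek s a)
exec₁ _                  s = s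

-- Threading rest lets instructions without demands on the register contents leave no trace in Safe.
Safe₁ : ℕ → Instr → State R → Set → Set
Safe₁ B (const d (+ c))    s rest = rest
Safe₁ B (copy d a)         s rest = rest
Safe₁ B (arith add d a b)  s rest = rest
Safe₁ B (arith mul d a b)  s rest = rest
Safe₁ B (arith op d a b)   s rest = Defined op (peek s a) (peek s b) × rest
Safe₁ B (load d p)         s rest = peek s p < B × rest
Safe₁ B (store p a)        s rest = peek s p < B × rest
Safe₁ B _                  s rest = ⊥

exec : List Instr → State R → State R
exec []       s = s
exec (i ∷ is) s = exec is (exec₁ i s)

Safe : ℕ → List Instr → State R → Set
Safe B []       s = ⊤
Safe B (i ∷ is) s = Safe₁ B i s (Safe B is (exec₁ i s))

-- Boolean, so that for a concrete block the condition evaluates to the unit type and is inferred.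
-- Only operands named in the instruction are tested; indirect addresses are bounded by `Safe`.
direct : ℕ → Instr → Bool
direct R (const d _)     = d <ᵇ R
direct R (copy d a)      = (d <ᵇ R) ∧ (a <ᵇ R)
direct R (arith _ d a b) = (d <ᵇ R) ∧ ((a <ᵇ R) ∧ (b <ᵇ R))
direct R (load d p)      = (d <ᵇ R) ∧ (p <ᵇ R)
direct R (store p a)     = (p <ᵇ R) ∧ (a <ᵇ R)
direct R _               = true

allDirect : ℕ → List Instr → Bool
allDirect R []       = true
allDirect R (i ∷ is) = direct R i ∧ allDirect R is

∧⁻ : ∀ {a b} → IsTrue (a ∧ b) → IsTrue a × IsTrue b
∧⁻ {true} {true} _ = _ , _

record Step (R B pc : ℕ) (i : Instr) (m : Memory) (s : State R) : Set where
  constructor mkStep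
  field
    {mem′}  : Memory
    steps   : step i ⟨ pc , m ⟩ ≡ just ⟨ suc pc , mem′ ⟩
    similar : mem′ ≈ s
    bounded : extent (accessed i m) ≤ B

step-correct : ∀ {B pc m rest} {s : State R} → R ≤ B → m ≈ s → ∀ i → IsTrue (direct R i) →
               Safe₁ B i s rest → Step R B pc i m (exec₁ i s) × rest
step-correct {R} {B} {pc} {m} {s = s} R≤B m≈s = go
  where
  lt : ∀ {a} → IsTrue (a <ᵇ R) → a < B
  lt {a} t = <-≤-trans (<ᵇ⇒< a R t) R≤B

  eqs : ∀ {op} a b → Defined op (peek s a) (peek s b) →
        ⟦ op ⟧ (m a) (m b) ≡ just (+ ⟦ op ⟧ₙ (peek s a) (peek s b))
  eqs {op} a b def rewrite m≈s .at a | m≈s .at b = ⟦⟧-correct op _ _ def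

  arith-step : ∀ op d a b → IsTrue (direct R (arith op d a b)) → Defined op (peek s a) (peek s b) →
               Step R B pc (arith op d a b) m (exec₁ (arith op d a b) s)
  arith-step op d a b t def
    with td , tab ← ∧⁻ {d <ᵇ R} t
    with ta , tb ← ∧⁻ {a <ᵇ R} tab
    = mkStep (cong (Maybe.map _) (eqs a b def)) (≈-poke d m≈s refl)
        (⊔-lub (lt td) (⊔-lub (lt ta) (⊔-lub (lt tb) z≤n)))

  go : ∀ {rest} i → IsTrue (direct R i) → Safe₁ B i s rest → Step R B pc i m (exec₁ i s) × rest
  go (const d (+ c)) t rest =
    mkStep refl (≈-poke d m≈s refl) (⊔-lub (lt t) z≤n) , rest
  go (copy d a) t rest
    with td , ta ← ∧⁻ {d <ᵇ R} t
    = mkStep refl (≈-poke d m≈s (m≈s .at a)) (⊔-lub (lt td) (⊔-lub (lt ta) z≤n)) , rest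
  go (arith add d a b) t rest         = arith-step add d a b t _ , rest
  go (arith sub d a b) t (def , rest) = arith-step sub d a b t def , rest
  go (arith mul d a b) t rest         = arith-step mul d a b t _ , rest
  go (arith div d a b) t (def , rest) = arith-step div d a b t def , rest
  go (arith mod d a b) t (def , rest) = arith-step mod d a b t def , rest
  go (load d p) t (p<B , rest)
    with td , tp ← ∧⁻ {d <ᵇ R} t
    = mkStep (cong (λ x → Maybe.map (λ a → ⟨ suc pc , m [ d ≔ m a ] ⟩) (address x)) (m≈s .at p)) (≈-poke d m≈s (m≈s .at _))
        (⊔-lub (lt td) (⊔-lub (lt tp) (⊔-lub (subst (λ x → ∣ x ∣ < B) (sym (m≈s .at p)) p<B) z≤n))) , rest
  go (store p a) t (p<B , rest)
    with tp , ta ← ∧⁻ {p <ᵇ R} t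
    = mkStep (cong (λ x → Maybe.map (λ b → ⟨ suc pc , m [ b ≔ m a ] ⟩) (address x)) (m≈s .at p)) (≈-poke _ m≈s (m≈s .at a))
        (⊔-lub (lt tp) (⊔-lub (lt ta) (⊔-lub (subst (λ x → ∣ x ∣ < B) (sym (m≈s .at p)) p<B) z≤n))) , rest
  go (const d -[1+ _ ]) t ()
  go (jump _) t ()
  go (jumpZero _ _) t ()
  go (jumpPos _ _) t ()
  go halt t ()

-- Chaining blocks and jumps with time and space bounds

drop-suc : ∀ {A : Set} pc (p : List A) {i is} → drop pc p ≡ i ∷ is → drop (suc pc) p ≡ is
drop-suc zero     (_ ∷ p) refl = refl
drop-suc (suc pc) (_ ∷ p) eq   = drop-suc pc p eq

module Execution (p : Program) (B out : ℕ) where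

  Outcome : Config → ℕ → Set
  Outcome c τ =
    Σ[ t ∈ ℕ ] Σ[ b ∈ ℕ ] Σ[ m ∈ Memory ] (Run p c t b m × output m ≡ + out × t ≤ τ × b ≤ B)

  -- A precondition for successful termination: specifications are composed backwards, from the rest
  -- of the run to its beginning. All memories represented by the state are covered because memories
  -- are functions and the representation fixes them only pointwise.
  record Halts (pc : ℕ) (s : State R) (τ : ℕ) : Set where
    constructor halts
    field
      outcome : ∀ {m} → m ≈ s → Outcome ⟨ pc , m ⟩ τ

  open Halts

  Halts-≤ : ∀ {pc τ τ′} {s : State R} → τ ≤ τ′ → Halts pc s τ → Halts pc s τ′
  Halts-≤ τ≤τ′ H .outcome m≈s with t , b , m′ , run , o , t≤ , b≤ ← H .outcome m≈s =
    t , b , m′ , run , o , ≤-trans t≤ τ≤τ′ , b≤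

  -- Allows one memory to be read with different numbers of listed registers, 7 while booting and 21
  -- afterwards.
  Halts-view : ∀ {R′ pc τ} {s : State R} {s′ : State R′} → (∀ a → peek s a ≡ peek s′ a) →
               Halts pc s′ τ → Halts pc s τ
  Halts-view eq H .outcome m≈s =
    H .outcome (represents λ a → trans (m≈s .at a) (cong +_ (eq a)))

  run-step : ∀ {pc τ i m c} → fetch p pc ≡ just i → step i ⟨ pc , m ⟩ ≡ just c →
             extent (accessed i m) ≤ B → Outcome c τ → Outcome ⟨ pc , m ⟩ (suc τ)
  run-step f st ext (t , b , m′ , run , o , t≤ , b≤) =
    suc t , _ , m′ , (f , st) then run , o , s≤s t≤ , ⊔-lub ext b≤

  block : ∀ {R pc τ} {s : State R} is {is′} → drop pc p ≡ is ++ is′ → R ≤ B →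
          {IsTrue (allDirect R is)} → Safe B is s →
          Halts (length is + pc) (exec is s) τ → Halts pc s (length is + τ)
  block [] _ _ _ H = H
  block {R} {pc} {τ} {s} (i ∷ is) eq R≤B {dir} safe H .outcome m≈s
    with di , dis ← ∧⁻ {direct R i} dir
    with mkStep steps similar bounded , safe′ ← step-correct {pc = pc} R≤B m≈s i di safe
    = run-step (cong head eq) steps bounded
        (block is (drop-suc pc p eq) R≤B {dis} safe′
          (subst (λ x → Halts x (exec is (exec₁ i s)) τ) (sym (+-suc (length is) pc)) H) .outcome similar)

  goto : ∀ {pc τ l} {s : State R} → fetch p pc ≡ just (jump l) →
         Halts l s τ → Halts pc s (suc τ)
  goto f H .outcome m≈s = run-step f refl z≤n (H .outcome m≈s)

  skip : ∀ {R pc τ r l v} {s : State R} → fetch p pc ≡ just (jumpZero r l) → r < B →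
         peek s r ≡ suc v → Halts (suc pc) s τ → Halts pc s (suc τ)
  skip {pc = pc} {r = r} {l} {s = s} f r<B eq H .outcome {m} m≈s =
    run-step f lemma (⊔-lub r<B z≤n) (H .outcome m≈s)
    where
    lemma : step (jumpZero r l) ⟨ pc , m ⟩ ≡ just ⟨ suc pc , m ⟩
    lemma rewrite trans (m≈s .at r) (cong +_ eq) = refl

  branch : ∀ {R pc τ r l} {s : State R} → fetch p pc ≡ just (jumpZero r l) → r < B →
           peek s r ≡ 0 → Halts l s τ → Halts pc s (suc τ)
  branch {pc = pc} {r = r} {l} {s = s} f r<B eq H .outcome {m} m≈s =
    run-step f lemma (⊔-lub r<B z≤n) (H .outcome m≈s)
    where
    lemma : step (jumpZero r l) ⟨ pc , m ⟩ ≡ just ⟨ l , m ⟩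
    lemma rewrite trans (m≈s .at r) (cong +_ eq) = refl

  stop : ∀ {pc} {s : State R} → fetch p pc ≡ just halt → peek s 0 ≡ out → Halts pc s 1
  stop f eq .outcome {m} m≈s = 1 , 0 , m , halted f , trans (m≈s .at 0) (cong +_ eq) , ≤-refl , z≤n

-- Arithmetic performed by the program

÷-digits : ∀ a {x c} → x < c → (a * c + x) ÷ c ≡ a
÷-digits a {x} {suc c} x<c = begin
  (a * suc c + x) / suc c          ≡⟨ +-distrib-/-∣ˡ x (n∣m*n a) ⟩
  a * suc c / suc c + x / suc c    ≡⟨ cong₂ _+_ (m*n/n≡m a (suc c)) (m<n⇒m/n≡0 x<c) ⟩
  a + 0                            ≡⟨ +-identityʳ a ⟩
  a                                ∎
  where open ≡-Reasoning

rem-digits : ∀ a {x c} → x < c → (a * c + x) rem c ≡ x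
rem-digits a {x} {suc c} x<c = trans (%-remove-+ˡ x (n∣m*n a)) (m<n⇒m%n≡m x<c)

m÷[1+n]≡0 : ∀ {m n} → m ≤ n → m ÷ suc n ≡ 0
m÷[1+n]≡0 m≤n = m<n⇒m/n≡0 (s≤s m≤n)

m÷[1+n]>0 : ∀ {m n} → n < m → m ÷ suc n > 0
m÷[1+n]>0 n<m = m≥n⇒m/n>0 n<m

1÷[1+n]≡0 : ∀ {n} → n > 0 → 1 ÷ suc n ≡ 0
1÷[1+n]≡0 n>0 = m<n⇒m/n≡0 (s≤s n>0)

-- c ÷ suc a is positive exactly when a < c, and (t + t) ÷ suc t is the sign of t.
𝟙-<-÷ : ∀ a c → (c ÷ suc a + c ÷ suc a) ÷ suc (c ÷ suc a) ≡ 𝟙 (a <? c)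
𝟙-<-÷ a c with a <? c
... | no a≮c  = trans (cong (λ t → (t + t) ÷ suc t) (m÷[1+n]≡0 (≮⇒≥ a≮c))) (sym (𝟙-no (a <? c) a≮c))
... | yes a<c = trans (sign (m÷[1+n]>0 a<c)) (sym (𝟙-yes (a <? c) a<c))
  where
  sign : ∀ {t} → t > 0 → (t + t) ÷ suc t ≡ 1
  sign {suc t} _ = trans (cong (_÷ suc (suc t)) (lemma t)) (÷-digits 1 (m<n⇒m<1+n (n<1+n t)))
    where
    lemma : ∀ t → suc t + suc t ≡ 1 * suc (suc t) + t
    lemma = solve-∀

-- The sum of the two quotients is 0 when a = c. Otherwise the larger number divided by one more
-- than the smaller is positive, and 1 is divided by at least 2.
𝟙-≡-÷ : ∀ a c → 1 ÷ suc (a ÷ suc c + c ÷ suc a) ≡ 𝟙 (a ≟ c)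
𝟙-≡-÷ a c with <-cmp a c
... | tri< a<c a≢c _ =
  trans (1÷[1+n]≡0 (<-≤-trans (m÷[1+n]>0 a<c) (m≤n+m _ (a ÷ suc c)))) (sym (𝟙-no (a ≟ c) a≢c))
... | tri> _ a≢c c<a =
  trans (1÷[1+n]≡0 (<-≤-trans (m÷[1+n]>0 c<a) (m≤m+n (a ÷ suc c) _))) (sym (𝟙-no (a ≟ c) a≢c))
... | tri≈ _ refl _ =
  trans (cong (λ t → 1 ÷ suc (t + t)) (m÷[1+n]≡0 {a} ≤-refl)) (sym (𝟙-yes (a ≟ a) refl))

1÷[1+bord]≡unb : ∀ (v : Word k) → 1 ÷ suc (bord v) ≡ unb v
1÷[1+bord]≡unb v with short? (pred (length v)) v
... | yes _ = refl
... | no _  = refl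

-- What the program remembers about a prefix, in the register that held its last letter.
cell : Word k → ℕ
cell u = below u unb * 2 + unb u

unb<2 : ∀ (u : Word k) → unb u < 2
unb<2 u = s≤s (m+n≤o⇒m≤o (unb u) (≤-reflexive (𝟙-¬ (short? (pred (length u)) u))))

-- In base k the three factors are three digit blocks of `val y`, with place values k^(m + i), k^i
-- and 1. The additive form of `len` encodes 2i ≤ `length y` without truncated subtraction.
module Slices (y : Word k) (i m : ℕ) (len : i + (m + i) ≡ length y) where

  w₁ w₂ w₃ : Word k
  w₁ = take i y
  w₂ = take m (drop i y)
  w₃ = drop m (drop i y)

  y≡ : w₁ ++ w₂ ++ w₃ ≡ y
  y≡ = trans (cong (w₁ ++_) (take++drop≡id m (drop i y))) (take++drop≡id i y)

  |rest| : length (drop i y) ≡ m + i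
  |rest| = trans (length-drop i y) (trans (cong (_∸ i) (sym len)) (m+n∸m≡n i (m + i)))

  |w₁| : length w₁ ≡ i
  |w₁| = trans (length-take i y) (m≤n⇒m⊓n≡m (subst (i ≤_) len (m≤m+n i _)))

  |w₂| : length w₂ ≡ m
  |w₂| = trans (length-take m (drop i y)) (m≤n⇒m⊓n≡m (subst (m ≤_) (sym |rest|) (m≤m+n m i)))

  |w₃| : length w₃ ≡ i
  |w₃| = trans (length-drop m (drop i y)) (trans (cong (_∸ m) |rest|) (m+n∸m≡n m i))

  val₂< : val w₂ < k ^ m
  val₂< = subst (λ n → val w₂ < k ^ n) |w₂| (val<k^ w₂)

  val₃< : val w₃ < k ^ i
  val₃< = subst (λ n → val w₃ < k ^ n) |w₃| (val<k^ w₃)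

  val-y : val y ≡ (val w₁ * k ^ m + val w₂) * k ^ i + val w₃
  val-y = begin
    val y                                                      ≡⟨ cong val y≡ ⟨
    val (w₁ ++ w₂ ++ w₃)                                       ≡⟨ val-++ w₁ (w₂ ++ w₃) ⟩
    val w₁ * k ^ length (w₂ ++ w₃) + val (w₂ ++ w₃)            ≡⟨ cong₂ (λ n z → val w₁ * k ^ n + z) (trans (length-++ w₂) (cong₂ _+_ |w₂| |w₃|)) (val-++ w₂ w₃) ⟩
    val w₁ * k ^ (m + i) + (val w₂ * k ^ length w₃ + val w₃)   ≡⟨ cong₂ (λ n z → val w₁ * n + (val w₂ * k ^ z + val w₃)) (^-distribˡ-+-* k m i) |w₃| ⟩
    val w₁ * (k ^ m * k ^ i) + (val w₂ * k ^ i + val w₃)       ≡⟨ lemma (val w₁) (k ^ m) (k ^ i) (val w₂) (val w₃) ⟩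
    (val w₁ * k ^ m + val w₂) * k ^ i + val w₃                 ∎
    where
    open ≡-Reasoning
    lemma : ∀ a q p b c → a * (q * p) + (b * p + c) ≡ (a * q + b) * p + c
    lemma = solve-∀

  suffix≡ : val y rem k ^ i ≡ val w₃
  suffix≡ = trans (cong (_rem k ^ i) val-y) (rem-digits (val w₁ * k ^ m + val w₂) val₃<)

  front≡ : val y ÷ k ^ i ≡ val w₁ * k ^ m + val w₂
  front≡ = trans (cong (_÷ k ^ i) val-y) (÷-digits (val w₁ * k ^ m + val w₂) val₃<)

  middle≡ : (val y ÷ k ^ i) rem k ^ m ≡ val w₂
  middle≡ = trans (cong (_rem k ^ m) front≡) (rem-digits (val w₁) val₂<)

  prefix≡ : val y ÷ (k ^ i * k ^ m) ≡ val w₁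
  prefix≡ = trans (cong (_÷ (k ^ i * k ^ m)) (trans val-y (lemma (val w₁) (k ^ m) (k ^ i) (val w₂) (val w₃))))
                  (÷-digits (val w₁) (subst (val w₂ * k ^ i + val w₃ <_) (*-comm (k ^ m) (k ^ i)) (digit-bound val₂< val₃<)))
    where
    lemma : ∀ a q p b c → (a * q + b) * p + c ≡ a * (p * q) + (b * p + c)
    lemma = solve-∀

  matches≡ : 𝟙 (matches? i y) ≡ 𝟙 (val w₁ ≟ val w₃)
  matches≡ = 𝟙-cong (matches? i y) (val w₁ ≟ val w₃)
    (λ eq → cong val (trans eq drop≡))
    (λ eq → trans (val-injective w₁ w₃ (trans |w₁| (sym |w₃|)) eq) (sym drop≡))
    where
    drop≡ : drop (length y ∸ i) y ≡ w₃
    drop≡ = trans (cong (λ n → drop n y) (trans (cong (_∸ i) (trans (sym len) (sym (+-assoc i m i)))) (m+n∸n≡m (i + m) i)))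
                  (sym (drop-drop i m y))

  below-matches : below y (λ v → unb (take i v) * 𝟙 (matches? i v)) ≡
                  below w₁ unb * k ^ m + unb w₁ * (val w₂ + 𝟙 (val w₁ <? val w₃))
  below-matches = begin
    below y (λ v → unb (take i v) * 𝟙 (matches? i v))
      ≡⟨ cong₂ (λ z j → below z (λ v → unb (take j v) * 𝟙 (matches? j v))) y≡ |w₁| ⟨
    below (w₁ ++ w₂ ++ w₃) (λ v → unb (take (length w₁) v) * 𝟙 (matches? (length w₁) v))
      ≡⟨ below-border w₁ w₂ w₃ (trans |w₃| (sym |w₁|)) ⟩
    below w₁ unb * k ^ length w₂ + unb w₁ * (val w₂ + 𝟙 (val w₁ <? val w₃))
      ≡⟨ cong (λ n → below w₁ unb * k ^ n + unb w₁ * (val w₂ + 𝟙 (val w₁ <? val w₃))) |w₂| ⟩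
    below w₁ unb * k ^ m + unb w₁ * (val w₂ + 𝟙 (val w₁ <? val w₃)) ∎
    where open ≡-Reasoning

-- The mathematical content of one inner round. The left sides of `sum-step` and `flag-step` have
-- the shape in which the instructions leave the registers, so they fit the execution without
-- rewriting.
module BorderStep (y : Word k) (b m : ℕ) (len : suc b + (m + suc b) ≡ length y)
            {z q S T : ℕ} (z≡ : z ≡ cell (take (suc b) y)) (q≡ : q ≡ k ^ m)
            (S≡ : S ≡ below y (λ v → 𝟙 (short? b v))) (T≡ : T ≡ 𝟙 (short? b y)) where

  open Slices y (suc b) m len

  private
    p = k ^ suc b
    a = val y ÷ (p * q)
    c = val y rem p

    U≡ : z ÷ 2 ≡ below w₁ unb
    U≡ = trans (cong (_÷ 2) z≡) (÷-digits (below w₁ unb) (unb<2 w₁))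

    N≡ : z rem 2 ≡ unb w₁
    N≡ = trans (cong (_rem 2) z≡) (rem-digits (below w₁ unb) (unb<2 w₁))

    a≡ : a ≡ val w₁
    a≡ = trans (cong (λ x → val y ÷ (p * x)) q≡) prefix≡

    middle : (val y ÷ p) rem q ≡ val w₂
    middle = trans (cong (λ x → (val y ÷ p) rem x) q≡) middle≡

    b<|y| : suc b ≤ length y
    b<|y| = subst (suc b ≤_) len (m≤m+n (suc b) _)

  sum-step : S + (z ÷ 2) * q + (z rem 2) * ((val y ÷ p) rem q + (c ÷ suc a + c ÷ suc a) ÷ suc (c ÷ suc a)) ≡
             below y (λ v → 𝟙 (short? (suc b) v))
  sum-step = begin
    S + (z ÷ 2) * q + (z rem 2) * ((val y ÷ p) rem q + (c ÷ suc a + c ÷ suc a) ÷ suc (c ÷ suc a))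
      ≡⟨ cong₂ (λ x x′ → S + x + x′) (cong₂ _*_ U≡ q≡)
           (cong₂ _*_ N≡ (cong₂ _+_ middle (trans (𝟙-<-÷ a c) (cong₂ (λ x x′ → 𝟙 (x <? x′)) a≡ suffix≡)))) ⟩
    S + below w₁ unb * k ^ m + unb w₁ * (val w₂ + 𝟙 (val w₁ <? val w₃))
      ≡⟨ +-assoc S _ _ ⟩
    S + (below w₁ unb * k ^ m + unb w₁ * (val w₂ + 𝟙 (val w₁ <? val w₃)))
      ≡⟨ cong₂ _+_ S≡ (sym below-matches) ⟩
    below y (λ v → 𝟙 (short? b v)) + below y (λ v → unb (take (suc b) v) * 𝟙 (matches? (suc b) v))
      ≡⟨ below-+ y _ _ ⟨
    below y (λ v → 𝟙 (short? b v) + unb (take (suc b) v) * 𝟙 (matches? (suc b) v))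
      ≡⟨ below-cong y (λ v |v| → 𝟙-short-suc b v (subst (suc b ≤_) (sym |v|) b<|y|)) ⟨
    below y (λ v → 𝟙 (short? (suc b) v)) ∎
    where open ≡-Reasoning

  -- Plain addition keeps the flag at 0 or 1: a new matching length contributes only if its prefix
  -- is unbordered, that is, if no shorter length has matched.
  flag-step : T + (z rem 2) * (1 ÷ suc (a ÷ suc c + c ÷ suc a)) ≡ 𝟙 (short? (suc b) y)
  flag-step = begin
    T + (z rem 2) * (1 ÷ suc (a ÷ suc c + c ÷ suc a))
      ≡⟨ cong₂ _+_ T≡ (cong₂ _*_ N≡ (trans (𝟙-≡-÷ a c) (trans (cong₂ (λ x x′ → 𝟙 (x ≟ x′)) a≡ suffix≡) (sym matches≡)))) ⟩
    𝟙 (short? b y) + unb w₁ * 𝟙 (matches? (suc b) y)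
      ≡⟨ 𝟙-short-suc b y b<|y| ⟨
    𝟙 (short? (suc b) y) ∎
    where open ≡-Reasoning

below-0 : ∀ (y : Word k) → below y (λ _ → 0) ≡ 0
below-0 {k} y = ∑-0 (words k (length y)) (λ {v} _ → *-zeroʳ (𝟙 (val v <? val y)))

val∸below-bord : ∀ (y : Word k) → val y ∸ below y bord ≡ below y unb
val∸below-bord y = trans (cong (_∸ below y bord) (sym (below-unb+bord y))) (m+n∸n≡m _ (below y bord))

below-bord≤val : ∀ (y : Word k) → below y bord ≤ val y
below-bord≤val y = subst (below y bord ≤_) (below-unb+bord y) (m≤n+m _ _)

letter : Word k → ℕ → ℕ
letter []      _       = 0
letter (x ∷ w) zero    = suc (toℕ x)
letter (x ∷ w) (suc i) = letter w i

take-suc : ∀ (w : Word k) {j} → j < length w →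
           Σ[ x ∈ Fin k ] (letter w j ≡ suc (toℕ x) × take (suc j) w ≡ take j w ++ x ∷ [])
take-suc (x ∷ w) {zero}  _         = x , refl , refl
take-suc (x ∷ w) {suc j} (s≤s j<w) with a , l , t ← take-suc w j<w = a , l , cong (x ∷_) t

1≤letter : ∀ (w : Word k) {j} → j < length w → 1 ≤ letter w j
1≤letter w j<w with x , l , _ ← take-suc w j<w rewrite l = s≤s z≤n

-- A Horner step; the subtraction turns the letters 1, ..., k of the input into the digits 0, ..., k
-- - 1.
val-take-suc : ∀ (w : Word k) {j} → j < length w →
               val (take j w) * k + (letter w j ∸ 1) ≡ val (take (suc j) w)
val-take-suc {k} w {j} j<w with x , l , t ← take-suc w j<w rewrite l | t | val-++ (take j w) (x ∷ []) =
  cong₂ (λ a b → val (take j w) * a + b) (sym (*-identityʳ k))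
    (sym (trans (+-identityʳ _) (*-identityʳ (toℕ x))))

-- The boot code moves the word to the registers from 64 n on.  At the start only R₁ is free, and
-- 64 n lies beyond the word and beyond the 21 working registers; R₂, …, R₆ are saved one by one
-- before a loop can run.  Afterwards the working registers are
--    0 k           1 cell of y    2 one     3 two     4 k²     5 first cell   6 prefixes left
--    7 L = ∣y∣     8 k^L          9 val y  10 bordered words below y with a border of length ≤ b
--   11 [y has a border of length ≤ b]      12 k^b    13 k^(L − 2b)   14 cell b
--   15 borders left   16–20 scratch
bootScale bootSave₁ bootSave₂ bootSave₃ copyBody initMain₁ initMain₂ : List Instr
outerHead₁ outerHead₂ outerHead₃ outerTail₁ outerTail₂ : List Instr
inner₁ inner₂ inner₃ inner₄ inner₅ inner₆ inner₇ : List Instr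

bootScale =
  arith add 1 1 1 ∷ arith add 1 1 1 ∷ arith add 1 1 1 ∷
  arith add 1 1 1 ∷ arith add 1 1 1 ∷ arith add 1 1 1 ∷ []

bootSave₁ = store 1 2 ∷ const 2 (+ 1) ∷ arith add 1 2 1 ∷ store 1 3 ∷ arith add 1 2 1 ∷ store 1 4 ∷ []
bootSave₂ = arith add 1 2 1 ∷ store 1 5 ∷ arith add 1 2 1 ∷ store 1 6 ∷ []
bootSave₃ = const 3 (+ 7) ∷ const 4 (+ 64) ∷ arith div 5 1 4 ∷ copy 6 5 ∷ []

copyBody = load 4 3 ∷ arith add 1 2 1 ∷ store 1 4 ∷ arith add 3 2 3 ∷ arith sub 6 6 2 ∷ []

initMain₁ = const 3 (+ 64) ∷ arith mul 1 5 3 ∷ copy 6 5 ∷ copy 5 1 ∷ const 3 (+ 2) ∷ []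
initMain₂ = arith mul 4 0 0 ∷ const 7 (+ 0) ∷ const 8 (+ 1) ∷ const 9 (+ 0) ∷ const 10 (+ 0) ∷ []

outerHead₁ = arith add 7 2 7 ∷ arith mul 8 0 8 ∷ load 16 1 ∷ arith sub 16 16 2 ∷ []
outerHead₂ = arith mul 9 9 0 ∷ arith add 9 9 16 ∷ const 10 (+ 0) ∷ const 11 (+ 0) ∷ []
outerHead₃ = const 12 (+ 1) ∷ copy 13 8 ∷ copy 14 5 ∷ arith div 15 7 3 ∷ []

inner₁ = arith mul 12 0 12 ∷ arith div 13 13 4 ∷ load 16 14 ∷ arith add 14 2 14 ∷ []
inner₂ = arith mod 17 16 3 ∷ arith div 16 16 3 ∷ arith mul 18 12 13 ∷ arith div 18 9 18 ∷ arith mod 19 9 12 ∷ []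
inner₃ = arith mul 16 16 13 ∷ arith add 10 10 16 ∷ arith div 16 9 12 ∷ arith mod 16 16 13 ∷ []
inner₄ = arith add 20 2 18 ∷ arith div 20 19 20 ∷ arith add 19 2 19 ∷ arith div 18 18 19 ∷ []
inner₅ = arith add 18 18 20 ∷ arith add 18 2 18 ∷ arith div 18 2 18 ∷ []
inner₆ = arith add 19 20 20 ∷ arith add 20 2 20 ∷ arith div 19 19 20 ∷ arith add 16 16 19 ∷ []
inner₇ = arith mul 16 17 16 ∷ arith add 10 10 16 ∷ arith mul 18 17 18 ∷ arith add 11 11 18 ∷ arith sub 15 15 2 ∷ []

outerTail₁ = arith add 11 2 11 ∷ arith div 11 2 11 ∷ arith sub 12 9 10 ∷ arith mul 12 12 3 ∷ arith add 12 12 11 ∷ []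
outerTail₂ = store 1 12 ∷ arith add 1 2 1 ∷ arith sub 6 6 2 ∷ []

-- Jump targets are absolute: 20 and 27 are head and exit of the copying loop, 37 and 90 of the loop
-- over prefixes, 50 and 81 of the loop over border lengths. The final addition uses the constant 1
-- in register 2, since ranks start from 1.
program : Program
program =
  bootScale ++ bootSave₁ ++ bootSave₂ ++ bootSave₃ ++
  jumpZero 6 27 ∷ copyBody ++ jump 20 ∷
  initMain₁ ++ initMain₂ ++
  jumpZero 6 90 ∷ outerHead₁ ++ outerHead₂ ++ outerHead₃ ++
  jumpZero 15 81 ∷ inner₁ ++ inner₂ ++ inner₃ ++ inner₄ ++ inner₅ ++ inner₆ ++ inner₇ ++ jump 50 ∷
  outerTail₁ ++ outerTail₂ ++ jump 37 ∷
  arith add 0 2 10 ∷ halt ∷ []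

-- Correctness and running time of the program

↦-same : ∀ h a v → (h ⟨ a ↦ v ⟩) a ≡ v
↦-same h a v rewrite dec-true (a ≟ a) refl = refl

↦-other : ∀ h {a x} v → x ≢ a → (h ⟨ a ↦ v ⟩) x ≡ h x
↦-other h {a} {x} v x≢a rewrite dec-false (x ≟ a) x≢a = refl

heapCells : ∀ r → Heap → Vec ℕ r
heapCells zero    h = []
heapCells (suc r) h = h 0 ∷ heapCells r (λ x → h (suc x))

peek-cells : ∀ {R} r (xs : Vec ℕ R) h a →
             peek (xs ∥ h) a ≡ peek (xs Vec.++ heapCells r h ∥ λ x → h (r + x)) a
peek-cells zero    []       h a       = refl
peek-cells (suc r) []       h zero    = refl
peek-cells (suc r) []       h (suc a) = peek-cells r [] (λ x → h (suc x)) a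
peek-cells r       (x ∷ xs) h zero    = refl
peek-cells r       (x ∷ xs) h (suc a) = peek-cells r xs h a

-- Cell `d` of the 21-register heap is register 64 n, where the moved word begins. The bound covers
-- 5 + n cells because copying overruns the word by five, and `n≤14+d` keeps the target clear of the
-- registers still to be copied.
module Correct {k : ℕ} {{_ : NonZero k}} (w : Word k) (d B : ℕ)
  (21≤B : 21 ≤ B) (bound : ∀ j → j < 5 + length w → 21 + (j + d) < B)
  (base≡ : length w * 64 ≡ 21 + d) (n≤14+d : length w ≤ 14 + d) where

  open Execution program B (rankB w)

  n = length w

  below-B : ∀ {r} → r < 21 → r < B
  below-B r<21 = <-≤-trans r<21 21≤B

  state : (ptr c L Q v S T p q bp e t₁ t₂ t₃ t₄ t₅ : ℕ) → Heap → State 21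
  state ptr c L Q v S T p q bp e t₁ t₂ t₃ t₄ t₅ h =
    k ∷ ptr ∷ 1 ∷ 2 ∷ k * k ∷ 21 + d ∷ c ∷ L ∷ Q ∷ v ∷ S ∷ T ∷ p ∷ q ∷ bp ∷ e ∷
    t₁ ∷ t₂ ∷ t₃ ∷ t₄ ∷ t₅ ∷ [] ∥ h

  private
    variable
      ptr c L Q v S T p q bp e t₁ t₂ t₃ t₄ t₅ τ : ℕ
      h : Heap

  -- This and the later block specifications hold by symbolic evaluation of `exec`. Their hypotheses
  -- are the nonzero divisors, admissible subtractions and bounded pointers of the block; cutting
  -- the code into short blocks with fresh variables keeps the terms small.
  inner₁-spec : NonZero (k * k) → 21 + bp < B →
    Halts 55 (state ptr c L Q v S T (k * p) (q ÷ (k * k)) (22 + bp) e (h bp) t₂ t₃ t₄ t₅ h) τ →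
    Halts 51 (state ptr c L Q v S T p q (21 + bp) e t₁ t₂ t₃ t₄ t₅ h) (4 + τ)
  inner₁-spec k²≢0 bp<B = block inner₁ refl 21≤B (k²≢0 , bp<B , _)

  inner₂-spec : NonZero (p * q) → NonZero p →
    Halts 60 (state ptr c L Q v S T p q bp e (t₁ ÷ 2) (t₁ rem 2) (v ÷ (p * q)) (v rem p) t₅ h) τ →
    Halts 55 (state ptr c L Q v S T p q bp e t₁ t₂ t₃ t₄ t₅ h) (5 + τ)
  inner₂-spec pq≢0 p≢0 = block inner₂ refl 21≤B (_ , _ , pq≢0 , p≢0 , _)

  inner₃-spec : NonZero p → NonZero q →
    Halts 64 (state ptr c L Q v (S + t₁ * q) T p q bp e ((v ÷ p) rem q) t₂ t₃ t₄ t₅ h) τ →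
    Halts 60 (state ptr c L Q v S T p q bp e t₁ t₂ t₃ t₄ t₅ h) (4 + τ)
  inner₃-spec p≢0 q≢0 = block inner₃ refl 21≤B (p≢0 , q≢0 , _)

  inner₄-spec :
    Halts 68 (state ptr c L Q v S T p q bp e t₁ t₂ (t₃ ÷ suc t₄) (suc t₄) (t₄ ÷ suc t₃) h) τ →
    Halts 64 (state ptr c L Q v S T p q bp e t₁ t₂ t₃ t₄ t₅ h) (4 + τ)
  inner₄-spec = block inner₄ refl 21≤B _

  inner₅-spec :
    Halts 71 (state ptr c L Q v S T p q bp e t₁ t₂ (1 ÷ suc (t₃ + t₅)) t₄ t₅ h) τ →
    Halts 68 (state ptr c L Q v S T p q bp e t₁ t₂ t₃ t₄ t₅ h) (3 + τ)
  inner₅-spec = block inner₅ refl 21≤B _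

  inner₆-spec :
    Halts 75 (state ptr c L Q v S T p q bp e (t₁ + (t₅ + t₅) ÷ suc t₅) t₂ t₃ ((t₅ + t₅) ÷ suc t₅) (suc t₅) h) τ →
    Halts 71 (state ptr c L Q v S T p q bp e t₁ t₂ t₃ t₄ t₅ h) (4 + τ)
  inner₆-spec = block inner₆ refl 21≤B _

  inner₇-spec :
    Halts 80 (state ptr c L Q v (S + t₂ * t₁) (T + t₂ * t₃) p q bp e (t₂ * t₁) t₂ (t₂ * t₃) t₄ t₅ h) τ →
    Halts 75 (state ptr c L Q v S T p q bp (suc e) t₁ t₂ t₃ t₄ t₅ h) (5 + τ)
  inner₇-spec = block inner₇ refl 21≤B (s≤s z≤n , _)

  module Inner (y : Word k) (|y|≤n : length y ≤ n) (h : Heap)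
               (cells : ∀ j → suc j < length y → h (j + d) ≡ cell (take (suc j) y))
               (ptr c L Q r : ℕ) where

    -- Invariant: b lengths are done, e remain, and `r` takes up the parity of the length. Writing
    -- the exponent of `q` as e * 2 + r makes each division by k² exact. A round costs 29
    -- straight-line instructions and two jumps.
    inner : ∀ {τ} e b {q S T t₁ t₂ t₃ t₄ t₅} →
            b + b + (e * 2 + r) ≡ length y →
            e + b ≡ length y / 2 →
            q ≡ k ^ (e * 2 + r) →
            S ≡ below y (λ v → 𝟙 (short? b v)) →
            T ≡ 𝟙 (short? b y) →
            (∀ {S T p q bp t₁ t₂ t₃ t₄ t₅} → S ≡ below y bord → T ≡ bord y →
              Halts 81 (state ptr c L Q (val y) S T p q bp 0 t₁ t₂ t₃ t₄ t₅ h) τ) →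
            Halts 50 (state ptr c L Q (val y) S T (k ^ b) q (21 + (b + d)) e t₁ t₂ t₃ t₄ t₅ h)
              (e * 31 + suc τ)
    inner zero b len half q≡ S≡ T≡ exit =
      branch refl (below-B (<ᵇ⇒< 15 21 _)) refl
        -- All lengths up to half are done, and by `𝟙-short-half` no longer ones have to be tried.
        (exit (trans S≡ (below-cong y (λ v |v| → trans (cong (λ x → 𝟙 (short? x v)) (trans half (cong (_/ 2) (sym |v|)))) (𝟙-short-half v))))
              (trans T≡ (trans (cong (λ x → 𝟙 (short? x y)) half) (𝟙-short-half y))))
    inner (suc e) b {q} {S} {T} len half q≡ S≡ T≡ exit =
      skip refl (below-B (<ᵇ⇒< 15 21 _)) refl
        (inner₁-spec k²≢0 (bound b b<n)
        (inner₂-spec p*q≢0 p≢0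
        (inner₃-spec p≢0 q≢0
        (inner₄-spec
        (inner₅-spec
        (inner₆-spec
        (inner₇-spec
        (goto refl
        (inner e (suc b) len₂ half′ q′≡ sum-step flag-step exit)))))))))
      where
      m = e * 2 + r
      len′ : suc b + (m + suc b) ≡ length y
      len′ = trans (lemma b m) len
        where
        lemma : ∀ b m → suc b + (m + suc b) ≡ b + b + suc (suc m)
        lemma = solve-∀
      len₂ : suc b + suc b + m ≡ length y
      len₂ = trans (lemma b m) len
        where
        lemma : ∀ b m → suc b + suc b + m ≡ b + b + suc (suc m)
        lemma = solve-∀
      half′ : e + suc b ≡ length y / 2
      half′ = trans (+-suc e b) half
      -- Strict, hence the table entry of this prefix was written in an earlier outer round.
      sb<|y| : suc b < length y
      sb<|y| = subst (suc b <_) len₂ (<-≤-trans (m<m+n (suc b) (s≤s z≤n)) (m≤m+n _ m))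
      b<n : b < 5 + n
      b<n = ≤-trans (<⇒≤ sb<|y|) (≤-trans |y|≤n (m≤n+m n 5))
      k²≢0 : NonZero (k * k)
      k²≢0 = m*n≢0 k k
      q′≡ : q ÷ (k * k) ≡ k ^ m
      q′≡ = trans (cong (_÷ (k * k)) (trans q≡ (lemma k (k ^ m)))) (÷-digits (k ^ m) (n≢0⇒n>0 (≢-nonZero⁻¹ (k * k) {{k²≢0}})))
        where
        lemma : ∀ k x → k * (k * x) ≡ x * (k * k) + 0
        lemma = solve-∀
      p≢0 : NonZero (k ^ suc b)
      p≢0 = m^n≢0 k (suc b)
      q≢0 : NonZero (q ÷ (k * k))
      q≢0 = subst NonZero (sym q′≡) (m^n≢0 k m)
      p*q≢0 : NonZero (k ^ suc b * (q ÷ (k * k)))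
      p*q≢0 = m*n≢0 _ _ {{p≢0}} {{q≢0}}
      open BorderStep y b m len′ {q = q ÷ (k * k)} (cells b sb<|y|) q′≡ S≡ T≡

  outerHead₁-spec : 21 + ptr < B → 1 ≤ h ptr →
    Halts 42 (state (21 + ptr) c (suc L) (k * Q) v S T p q bp e (h ptr ∸ 1) t₂ t₃ t₄ t₅ h) τ →
    Halts 38 (state (21 + ptr) c L Q v S T p q bp e t₁ t₂ t₃ t₄ t₅ h) (4 + τ)
  outerHead₁-spec ptr<B 1≤x = block outerHead₁ refl 21≤B (ptr<B , 1≤x , _)

  outerHead₂-spec :
    Halts 46 (state ptr c L Q (v * k + t₁) 0 0 p q bp e t₁ t₂ t₃ t₄ t₅ h) τ →
    Halts 42 (state ptr c L Q v S T p q bp e t₁ t₂ t₃ t₄ t₅ h) (4 + τ)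
  outerHead₂-spec = block outerHead₂ refl 21≤B _

  outerHead₃-spec :
    Halts 50 (state ptr c L Q v S T 1 Q (21 + d) (L ÷ 2) t₁ t₂ t₃ t₄ t₅ h) τ →
    Halts 46 (state ptr c L Q v S T p q bp e t₁ t₂ t₃ t₄ t₅ h) (4 + τ)
  outerHead₃-spec = block outerHead₃ refl 21≤B _

  outerTail₁-spec : S ≤ v →
    Halts 86 (state ptr c L Q v S (1 ÷ suc T) ((v ∸ S) * 2 + 1 ÷ suc T) q bp e t₁ t₂ t₃ t₄ t₅ h) τ →
    Halts 81 (state ptr c L Q v S T p q bp e t₁ t₂ t₃ t₄ t₅ h) (5 + τ)
  outerTail₁-spec S≤v = block outerTail₁ refl 21≤B (_ , S≤v , _)

  outerTail₂-spec : 21 + ptr < B →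
    Halts 89 (state (22 + ptr) c L Q v S T p q bp e t₁ t₂ t₃ t₄ t₅ (h ⟨ ptr ↦ p ⟩)) τ →
    Halts 86 (state (21 + ptr) (suc c) L Q v S T p q bp e t₁ t₂ t₃ t₄ t₅ h) (3 + τ)
  outerTail₂-spec ptr<B = block outerTail₂ refl 21≤B (ptr<B , s≤s z≤n , _)

  with-value : ∀ {v v′} → v ≡ v′ →
    Halts 50 (state ptr c L Q v′ S T p q bp e t₁ t₂ t₃ t₄ t₅ h) τ →
    Halts 50 (state ptr c L Q v S T p q bp e t₁ t₂ t₃ t₄ t₅ h) τ
  with-value refl H = H

  -- The table overwrites the word from the left: letter L is read only in the round that ends by
  -- storing into its cell.
  record Filled (L : ℕ) (h : Heap) : Set where
    field
      cells   : ∀ j → j < L → h (j + d) ≡ cell (take (suc j) w)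
      letters : ∀ j → L ≤ j → j < n → h (j + d) ≡ letter w j
  open Filled

  fill : ∀ {L h x} → Filled L h → x ≡ cell (take (suc L) w) → Filled (suc L) (h ⟨ L + d ↦ x ⟩)
  fill {L} {h} {x} F x≡ .cells j j<1+L with m≤n⇒m<n∨m≡n (s≤s⁻¹ j<1+L)
  ... | inj₁ j<L  = trans (↦-other h x (<⇒≢ (+-monoˡ-< d j<L))) (F .cells j j<L)
  ... | inj₂ refl = trans (↦-same h (L + d) x) x≡
  fill {L} {h} {x} F x≡ .letters j L<j j<n =
    trans (↦-other h x (≢-sym (<⇒≢ (+-monoˡ-< d L<j)))) (F .letters j (<⇒≤ L<j) j<n)

  -- `S` survives from the previous round, so at the end it is the count for w itself. Of the 23
  -- steps outside the inner rounds, 13 precede the inner loop, one leaves it and 9 follow; the last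
  -- 3 are the exit test, the final addition and `halt`.
  outer : ∀ c L → L + c ≡ n → Filled L h → v ≡ val (take L w) → S ≡ below (take L w) bord →
          Halts 37 (state (21 + (L + d)) c L (k ^ L) v S T p q bp e t₁ t₂ t₃ t₄ t₅ h)
            (c * (n * 31 + 23) + 3)
  outer zero L L≡n F v≡ S≡ =
    branch refl (below-B (<ᵇ⇒< 6 21 _)) refl
      (block (arith add 0 2 10 ∷ []) refl 21≤B _
        (stop refl (trans (cong suc S≡′) (sym (rankB≡ w)))))
    where
    S≡′ = trans S≡ (cong (λ y → below y bord)
            (take-all L w (≤-reflexive (sym (trans (sym (+-identityʳ L)) L≡n)))))
  outer {h = h} {v} (suc c) L L+c≡n F v≡ S≡ =
    Halts-≤ time
      (skip refl (below-B (<ᵇ⇒< 6 21 _)) refl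
      (outerHead₁-spec ptr<B (subst (1 ≤_) (sym x≡) (1≤letter w L<n))
      (outerHead₂-spec
      (outerHead₃-spec
      (with-value v′≡
      (Inner.inner y (≤-trans (≤-reflexive |y|) L<n) h cells′ _ _ _ _ (suc L % 2) (suc L / 2) 0
        (trans length≡ (sym |y|))
        (trans (+-identityʳ _) (cong (_/ 2) (sym |y|)))
        (cong (k ^_) (sym length≡))
        (sym (below-0 y)) refl
        (λ {S} {T} S≡ T≡ →
          outerTail₁-spec (subst (_≤ val y) (sym S≡) (below-bord≤val y))
          (outerTail₂-spec ptr<B
          (goto refl
          (outer c (suc L) (trans (sym (+-suc L c)) L+c≡n)
            (fill F (cong₂ (λ U N → U * 2 + N)
              (trans (cong (val y ∸_) S≡) (val∸below-bord y))
              (trans (cong (λ t → 1 ÷ suc t) T≡) (1÷[1+bord]≡unb y))))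
            refl S≡))))))))))
    where
    y : Word k
    y = take (suc L) w
    L<n : L < n
    L<n = subst (L <_) L+c≡n (m<m+n L (s≤s z≤n))
    ptr<B : 21 + (L + d) < B
    ptr<B = bound L (≤-trans L<n (m≤n+m n 5))
    x≡ : h (L + d) ≡ letter w L
    x≡ = F .letters L ≤-refl L<n
    v′≡ : v * k + (h (L + d) ∸ 1) ≡ val y
    v′≡ = trans (cong₂ (λ a x → a * k + (x ∸ 1)) v≡ x≡) (val-take-suc w L<n)
    |y| : length y ≡ suc L
    |y| = trans (length-take (suc L) w) (m≤n⇒m⊓n≡m L<n)
    length≡ : suc L / 2 * 2 + suc L % 2 ≡ suc L
    length≡ = trans (+-comm (suc L / 2 * 2) _) (sym (m≡m%n+[m/n]*n (suc L) 2))
    cells′ : ∀ j → suc j < length y → h (j + d) ≡ cell (take (suc j) y)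
    cells′ j j<|y| = trans (F .cells j j<L)
      (cong cell (sym (trans (take-take (suc j) (suc L) w)
        (cong (λ i → take i w) (m≤n⇒m⊓n≡m (<⇒≤ (s≤s j<L)))))))
      where
      j<L : j < L
      j<L = s≤s⁻¹ (subst (suc j <_) |y| j<|y|)
    rest = c * (n * 31 + 23)
    time : 13 + (suc L / 2 * 31 + (10 + (rest + 3))) ≤ (n * 31 + 23) + rest + 3
    time = begin
      13 + (suc L / 2 * 31 + (10 + (rest + 3)))  ≡⟨ lemma (suc L / 2 * 31) rest ⟩
      (suc L / 2 * 31 + 23) + rest + 3           ≤⟨ +-monoˡ-≤ 3 (+-monoˡ-≤ rest (+-monoˡ-≤ 23
                                                     (*-monoˡ-≤ 31 (≤-trans (m/n≤m (suc L) 2) L<n)))) ⟩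
      (n * 31 + 23) + rest + 3                   ∎
      where
      open ≤-Reasoning
      lemma : ∀ a r → 13 + (a + (10 + (r + 3))) ≡ (a + 23) + r + 3
      lemma = solve-∀

  bootState : (ptr src tmp n c : ℕ) → Heap → State 7
  bootState ptr src tmp n c h = k ∷ ptr ∷ 1 ∷ src ∷ tmp ∷ n ∷ c ∷ [] ∥ h

  -- The heap of a 7-register state starts 14 cells below the heap of a 21-register state.
  base : ℕ
  base = 14 + d

  record Copied (c : ℕ) (h : Heap) : Set where
    field
      source : ∀ x → x < base → h x ≡ letter w (5 + x)
      target : ∀ j → j < c → h (j + base) ≡ letter w j
  open Copied

  copied-suc : ∀ {c h x} → Copied c h → x ≡ letter w c → Copied (suc c) (h ⟨ c + base ↦ x ⟩)
  copied-suc {c} {h} {x} C x≡ .source j j<base =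
    trans (↦-other h x (<⇒≢ (<-≤-trans j<base (m≤n+m base c)))) (C .source j j<base)
  copied-suc {c} {h} {x} C x≡ .target j j<1+c with m≤n⇒m<n∨m≡n (s≤s⁻¹ j<1+c)
  ... | inj₁ j<c  = trans (↦-other h x (<⇒≢ (+-monoˡ-< base j<c))) (C .target j j<c)
  ... | inj₂ refl = trans (↦-same h (c + base) x) x≡

  7≤B : 7 ≤ B
  7≤B = ≤-trans (<ᵇ⇒< 6 21 _) 21≤B

  bound₇ : ∀ j → j < 5 + n → 7 + (j + base) < B
  bound₇ j j< = subst (_< B) (lemma j d) (bound j j<)
    where
    lemma : ∀ j d → 21 + (j + d) ≡ 7 + (j + (14 + d))
    lemma = solve-∀

  initMain₁-spec : ∀ {a₁ a₃ a₄ a₆} →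
    Halts 32 (k ∷ n * 64 ∷ 1 ∷ 2 ∷ a₄ ∷ n * 64 ∷ n ∷ L ∷ Q ∷ v ∷ S ∷ T ∷ p ∷ q ∷ bp ∷ e ∷
              t₁ ∷ t₂ ∷ t₃ ∷ t₄ ∷ t₅ ∷ [] ∥ h) τ →
    Halts 27 (k ∷ a₁ ∷ 1 ∷ a₃ ∷ a₄ ∷ n ∷ a₆ ∷ L ∷ Q ∷ v ∷ S ∷ T ∷ p ∷ q ∷ bp ∷ e ∷
              t₁ ∷ t₂ ∷ t₃ ∷ t₄ ∷ t₅ ∷ [] ∥ h) (5 + τ)
  initMain₁-spec = block initMain₁ refl 21≤B _

  initMain₂-spec : ∀ {a₄ x} → x ≡ 21 + d →
    Halts 37 (state (21 + d) n 0 1 0 0 T p q bp e t₁ t₂ t₃ t₄ t₅ h) τ →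
    Halts 32 (k ∷ x ∷ 1 ∷ 2 ∷ a₄ ∷ x ∷ n ∷ L ∷ Q ∷ v ∷ S ∷ T ∷ p ∷ q ∷ bp ∷ e ∷
              t₁ ∷ t₂ ∷ t₃ ∷ t₄ ∷ t₅ ∷ [] ∥ h) (5 + τ)
  initMain₂-spec refl = block initMain₂ refl 21≤B _

  -- The counter starts at n although five letters are already saved. The five surplus rounds copy
  -- zeros from beyond the word, which spares a separate treatment of words shorter than five.
  copyLoop : ∀ {tmp} c i → i + c ≡ n → Copied (5 + i) h →
             (∀ {ptr src tmp h} → Copied (5 + n) h → Halts 27 (bootState ptr src tmp n 0 h) τ) →
             Halts 20 (bootState (11 + (i + base)) (7 + i) tmp n c h) (c * 7 + suc τ)
  copyLoop zero i i≡n C exit =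
    branch refl (≤-trans (<ᵇ⇒< 6 7 _) 7≤B) refl
      (exit (subst (λ m → Copied (5 + m) _) (trans (sym (+-identityʳ i)) i≡n) C))
  copyLoop (suc c) i i+c≡n C exit =
    skip refl (≤-trans (<ᵇ⇒< 6 7 _) 7≤B) refl
      (block copyBody refl 7≤B
        (<-trans (+-monoʳ-< 7 (<-≤-trans i<base (m≤n+m base i))) (bound₇ i (≤-trans i<n (m≤n+m n 5)))
        , bound₇ (5 + i) (+-monoʳ-< 5 i<n) , s≤s z≤n , _)
      (goto refl
      (copyLoop c (suc i) (trans (sym (+-suc i c)) i+c≡n)
        (copied-suc C (C .source i i<base)) exit)))
    where
    i<n : i < n
    i<n = subst (i <_) i+c≡n (m<m+n i (s≤s z≤n))
    i<base : i < base
    i<base = <-≤-trans i<n n≤14+d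

  bootScale-spec : ∀ {x a₂ a₃ a₄ a₅ a₆} →
    Halts 6 (k ∷ x * 64 ∷ a₂ ∷ a₃ ∷ a₄ ∷ a₅ ∷ a₆ ∷ [] ∥ h) τ →
    Halts 0 (k ∷ x ∷ a₂ ∷ a₃ ∷ a₄ ∷ a₅ ∷ a₆ ∷ [] ∥ h) (6 + τ)
  bootScale-spec {x = x} H = block bootScale refl 7≤B _ (rescale (lemma x) H)
    where
    lemma : ∀ x → (((((x + x) + (x + x)) + ((x + x) + (x + x))) + (((x + x) + (x + x)) + ((x + x) + (x + x)))) +
                   ((((x + x) + (x + x)) + ((x + x) + (x + x))) + (((x + x) + (x + x)) + ((x + x) + (x + x))))) +
                  (((((x + x) + (x + x)) + ((x + x) + (x + x))) + (((x + x) + (x + x)) + ((x + x) + (x + x)))) +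
                   ((((x + x) + (x + x)) + ((x + x) + (x + x))) + (((x + x) + (x + x)) + ((x + x) + (x + x)))))
                  ≡ x * 64
    lemma = solve-∀
    rescale : ∀ {x x′ a₂ a₃ a₄ a₅ a₆} → x ≡ x′ →
      Halts 6 (k ∷ x′ ∷ a₂ ∷ a₃ ∷ a₄ ∷ a₅ ∷ a₆ ∷ [] ∥ h) τ →
      Halts 6 (k ∷ x ∷ a₂ ∷ a₃ ∷ a₄ ∷ a₅ ∷ a₆ ∷ [] ∥ h) τ
    rescale refl H = H

  bootSave₁-spec : ∀ {x a₂ a₃ a₄ a₅ a₆} → x ≡ 7 + base →
    Halts 12 (k ∷ 9 + base ∷ 1 ∷ a₃ ∷ a₄ ∷ a₅ ∷ a₆ ∷ [] ∥
              h ⟨ base ↦ a₂ ⟩ ⟨ 1 + base ↦ a₃ ⟩ ⟨ 2 + base ↦ a₄ ⟩) τ →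
    Halts 6 (k ∷ x ∷ a₂ ∷ a₃ ∷ a₄ ∷ a₅ ∷ a₆ ∷ [] ∥ h) (6 + τ)
  bootSave₁-spec refl =
    block bootSave₁ refl 7≤B (bound₇ 0 (s≤s z≤n) , bound₇ 1 (s≤s (s≤s z≤n)) , bound₇ 2 (s≤s (s≤s (s≤s z≤n))) , _)

  bootSave₂-spec : ∀ {a₃ a₄ a₅ a₆} →
    Halts 16 (k ∷ 11 + base ∷ 1 ∷ a₃ ∷ a₄ ∷ a₅ ∷ a₆ ∷ [] ∥ h ⟨ 3 + base ↦ a₅ ⟩ ⟨ 4 + base ↦ a₆ ⟩) τ →
    Halts 12 (k ∷ 9 + base ∷ 1 ∷ a₃ ∷ a₄ ∷ a₅ ∷ a₆ ∷ [] ∥ h) (4 + τ)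
  bootSave₂-spec =
    block bootSave₂ refl 7≤B
      (bound₇ 3 (s≤s (s≤s (s≤s (s≤s z≤n)))) , bound₇ 4 (s≤s (s≤s (s≤s (s≤s (s≤s z≤n))))) , _)

  bootSave₃-spec : ∀ {ptr a₃ a₄ a₅ a₆} → ptr ÷ 64 ≡ n →
    Halts 20 (bootState ptr 7 64 n n h) τ →
    Halts 16 (k ∷ ptr ∷ 1 ∷ a₃ ∷ a₄ ∷ a₅ ∷ a₆ ∷ [] ∥ h) (4 + τ)
  bootSave₃-spec {h = h} {τ = τ} {ptr = ptr} ptr≡ H =
    block bootSave₃ refl 7≤B _ (subst (λ x → Halts 20 (bootState ptr 7 64 x x h) τ) (sym ptr≡) H)

  main : ∀ {ptr src tmp h} → Copied (5 + n) h → Halts 27 (bootState ptr src tmp n 0 h) (13 + n * (n * 31 + 23))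
  main {ptr} {src} {tmp} {h} C =
    -- Registers 7 to 20 join the list with whatever they contain; each is overwritten before it is
    -- read.
    Halts-view (peek-cells 14 (k ∷ ptr ∷ 1 ∷ src ∷ tmp ∷ n ∷ 0 ∷ []) h)
      (Halts-≤ (≤-reflexive (lemma (n * (n * 31 + 23))))
      (initMain₁-spec (initMain₂-spec base≡ (outer n 0 refl filled refl refl))))
    where
    lemma : ∀ a → 10 + (a + 3) ≡ 13 + a
    lemma = solve-∀
    shift : ∀ j d → 14 + (j + d) ≡ j + (14 + d)
    shift = solve-∀
    filled : Filled 0 (λ x → h (14 + x))
    filled .cells j ()
    filled .letters j _ j<n =
      trans (cong h (shift j d)) (C .target j (≤-trans j<n (m≤n+m n 5)))

  start : Halts 0 (k ∷ n ∷ letter w 0 ∷ letter w 1 ∷ letter w 2 ∷ letter w 3 ∷ letter w 4 ∷ [] ∥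
                   λ x → letter w (5 + x))
            (34 + n * 7 + n * (n * 31 + 23))
  start =
    Halts-≤ (≤-reflexive (lemma (n * 7) (n * (n * 31 + 23))))
    (bootScale-spec
    (bootSave₁-spec base≡
    (bootSave₂-spec
    (bootSave₃-spec ptr≡
    (copyLoop n 0 refl saved main)))))
    where
    lemma : ∀ a b → 20 + (a + (14 + b)) ≡ 34 + a + b
    lemma = solve-∀
    -- After five saves the pointer is 64 n + 4, so dividing by 64 recovers n, whose register was
    -- used for the pointer.
    ptr≡ : (11 + base) ÷ 64 ≡ n
    ptr≡ = trans (cong (_÷ 64) (trans (+-comm 4 (21 + d)) (cong (_+ 4) (sym base≡))))
                 (÷-digits n (<ᵇ⇒< 4 64 _))
    saved = copied-suc (copied-suc (copied-suc (copied-suc (copied-suc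
              (record { source = λ _ _ → refl ; target = λ _ () }) refl) refl) refl) refl) refl

-- The input convention and the final bounds

letterAt≡ : ∀ {k} (w : Word k) i → letterAt w i ≡ + letter w i
letterAt≡ []      i       = refl
letterAt≡ (x ∷ w) zero    = refl
letterAt≡ (x ∷ w) (suc i) = letterAt≡ w i

input≈ : ∀ {k} (w : Word k) →
         input w ≈ (k ∷ length w ∷ letter w 0 ∷ letter w 1 ∷ letter w 2 ∷ letter w 3 ∷ letter w 4 ∷ [] ∥
                    λ x → letter w (5 + x))
input≈ w = represents λ
  { 0 → refl
  ; 1 → refl
  ; 2 → letterAt≡ w 0
  ; 3 → letterAt≡ w 1
  ; 4 → letterAt≡ w 2
  ; 5 → letterAt≡ w 3
  ; 6 → letterAt≡ w 4
  ; (suc (suc (suc (suc (suc (suc (suc x))))))) → letterAt≡ w (5 + x)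
  }

-- The constant is 34 + 30 + 31, the coefficients of the quadratic step count once every power of n
-- is raised to n².
time-bound : ∀ k n → 1 ≤ k → 1 ≤ n → 34 + n * 7 + n * (n * 31 + 23) ≤ 95 * (k * n ^ 3)
time-bound k n 1≤k 1≤n = begin
  34 + n * 7 + n * (n * 31 + 23)        ≡⟨ lemma n ⟩
  34 * 1 + 30 * n + 31 * (n * n)        ≤⟨ +-monoˡ-≤ (31 * (n * n)) (+-mono-≤ (*-monoʳ-≤ 34 (*-mono-≤ 1≤n 1≤n))
                                              (*-monoʳ-≤ 30 n≤n²)) ⟩
  34 * (n * n) + 30 * (n * n) + 31 * (n * n) ≡⟨ lemma₂ (n * n) ⟩
  95 * (1 * (1 * (n * n)))              ≤⟨ *-monoʳ-≤ 95 (*-mono-≤ 1≤k (*-monoˡ-≤ (n * n) 1≤n)) ⟩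
  95 * (k * (n * (n * n)))              ≡⟨ cong (λ x → 95 * (k * (n * (n * x)))) (*-identityʳ n) ⟨
  95 * (k * n ^ 3)                      ∎
  where
  open ≤-Reasoning
  n≤n² : n ≤ n * n
  n≤n² = subst (_≤ n * n) (*-identityʳ n) (*-monoʳ-≤ n 1≤n)
  lemma : ∀ n → 34 + n * 7 + n * (n * 31 + 23) ≡ 34 * 1 + 30 * n + 31 * (n * n)
  lemma = solve-∀
  lemma₂ : ∀ x → 34 * x + 30 * x + 31 * x ≡ 95 * (1 * (1 * x))
  lemma₂ = solve-∀

-- Here n is one less than the word length N, and 43 + 64 n is 64 N - 21. The highest address in use
-- is 65 N + 4, hence fewer than 70 N registers suffice.
space-bound : ∀ n j → j < 6 + n → 21 + (j + (43 + n * 64)) < 70 * suc n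
space-bound n j j<6+n = begin-strict
  21 + (j + (43 + n * 64))        <⟨ +-monoʳ-< 21 (+-monoˡ-< (43 + n * 64) j<6+n) ⟩
  21 + (6 + n + (43 + n * 64))    ≡⟨ lemma n ⟩
  70 + 65 * n                     ≤⟨ +-monoʳ-≤ 70 (*-monoˡ-≤ n (m≤m+n 65 5)) ⟩
  70 + 70 * n                     ≡⟨ *-suc 70 n ⟨
  70 * suc n                      ∎
  where
  open ≤-Reasoning
  lemma : ∀ n → 21 + (6 + n + (43 + n * 64)) ≡ 70 + 65 * n
  lemma = solve-∀

theorem9 : Σ[ p ∈ Program ] Σ[ A ∈ ℕ ] Σ[ B ∈ ℕ ]
    ((n k : ℕ) → 1 ≤ n → 2 ≤ k → (w : Word k) → length w ≡ n →
    Σ[ t ∈ ℕ ] Σ[ s ∈ ℕ ] Σ[ m ∈ Memory ]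
    (Run p (initial w) t s m
    × output m ≡ + rankB w
    × t ≤ A * (k * n ^ 3)
    × s ≤ B * n))
theorem9 = program , 95 , 70 , λ
  { n k 1≤n 2≤k w@(_ ∷ w′) refl →
      let n′ = length w′
          instance k≢0 = >-nonZero (≤-trans (s≤s z≤n) 2≤k)
          t , s , m , run , out≡ , t≤ , s≤ =
            Execution.Halts.outcome
              -- With the length in successor form, 21 + (43 + 64 n′) is 64 times the length by
              -- computation.
              (Correct.start w (43 + n′ * 64) (70 * suc n′)
                (≤-trans (m≤m+n 21 49) (m≤m*n 70 (suc n′)))
                (space-bound n′) refl
                (s≤s (≤-trans (m≤m*n n′ 64) (m≤n+m (n′ * 64) 56))))
              (input≈ w)
      in t , s , m , run , out≡ , ≤-trans t≤ (time-bound k n (≤-trans (s≤s z≤n) 2≤k) 1≤n) , s≤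
  }
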